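{- There is an absolute constant $C$ such that for every pair of integers $a\ge2$, $b\ge1$, every digraph $D$ with $\delta^+(D)\ge Cab^7$ and $\vec{g}(D)\ge 4b^2$ contains a subdivision of $C_{a,b}$.
   Context: Digraphs are finite, loopless, without parallel arcs, but may contain digons. $\delta^+(D)$ is the minimum out-degree and $\vec{g}(D)$ is the directed girth (minimum length of a directed cycle in $D$). For integers $a,b\ge1$, $C_{a,b}$ is the oriented cycle consisting of $2a$ vertices $s_1,\dots,s_a,t_1,\dots,t_a$ and $2a$ internally vertex-disjoint directed paths of length $b$: one from $s_i$ to $t_i$ and one from $s_i$ to $t_{i+1}$ for each $1\le i\le a$ (indices modulo $a$). A subdivision of a digraph $F$ is obtained by replacing each arc $(u,v)$ by a directed $u$-$v$ path, paths for different arcs being internally vertex-disjoint. -}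

module Defs where

open import Data.Nat using (ℕ; zero; suc; _∸_; _≤_; _<_)
open import Data.Nat.DivMod using (_%_; m%n<n)
open import Data.Fin using (Fin; zero; suc; toℕ; fromℕ; fromℕ<; inject₁)
open import Data.Bool using (Bool; true; false; T)
open import Data.List using (length; filter; allFin)
open import Data.Maybe using (Maybe; just; nothing; maybe′)
import Data.Maybe as Maybe
open import Data.Product using (Σ; ∃; _×_; _,_)
open import Data.Empty using (⊥)
open import Relation.Nullary using (¬_)
open import Relation.Nullary.Decidable using (T?)
open import Relation.Binary.PropositionalEquality using (_≡_; _≢_)
open import Function.Definitions using (Injective)

-- Host digraphs: finite vertex set Fin n, arc relation given by a Bool
-- adjacency (so no parallel arcs), loopless; digons are allowed.

record Digraph : Set where
  field
    n        : ℕ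
    adj      : Fin n → Fin n → Bool
    loopless : ∀ v → adj v v ≡ false
open Digraph public

outdeg : (D : Digraph) → Fin (n D) → ℕ
outdeg D v = length (filter (λ w → T? (adj D v w)) (allFin (n D)))

next : ∀ {a} → Fin a → Fin a
next {suc a} i = fromℕ< (m%n<n (suc (toℕ i)) (suc a))

DirCycle : (D : Digraph) → ℕ → Set
DirCycle D ℓ =
  2 ≤ ℓ × Σ (Fin ℓ → Fin (n D)) λ c →
    Injective _≡_ _≡_ c × (∀ i → T (adj D (c i) (c (next i))))

-- directed girth is at least g (vacuous if D is acyclic: girth = ∞)
GirthAtLeast : Digraph → ℕ → Set
GirthAtLeast D g = ∀ ℓ → DirCycle D ℓ → g ≤ ℓ

record Path (D : Digraph) (x y : Fin (n D)) : Set where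
  field
    len    : ℕ
    vtx    : Fin (suc len) → Fin (n D)
    inj    : Injective _≡_ _≡_ vtx
    start  : vtx zero ≡ x
    finish : vtx (fromℕ len) ≡ y
    arcs   : ∀ (k : Fin len) → T (adj D (vtx (inject₁ k)) (vtx (suc k)))
open Path public

Internal : ∀ {D x y} → Path D x y → Fin (n D) → Set
Internal P w = ∃ λ k → 0 < toℕ k × toℕ k < len P × vtx P k ≡ w

record Quiver : Set₁ where
  field
    V   : Set
    E   : Set
    src : E → V
    tgt : E → V

record Subdivision (F : Quiver) (D : Digraph) : Set where
  open Quiver F
  field
    φ      : V → Fin (n D)
    φ-inj  : Injective _≡_ _≡_ φ
    path   : (e : E) → Path D (φ (src e)) (φ (tgt e))
    avoid  : ∀ e v w → Internal (path e) w → φ v ≢ w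
    disj   : ∀ e e' w → e ≢ e' → Internal (path e) w → Internal (path e') w → ⊥

-- vertices: s_i, t_i, and the b-1 internal vertices of the path
-- (i, κ) where κ = false is the s_i→t_i path, κ = true the s_i→t_{i+1} path
data CVertex (a b : ℕ) : Set where
  s   : Fin a → CVertex a b
  t   : Fin a → CVertex a b
  mid : Fin a → Bool → Fin (b ∸ 1) → CVertex a b

step : (b : ℕ) → Fin b → Maybe (Fin (b ∸ 1))
step (suc zero) zero = nothing
step (suc (suc b)) zero = just zero
step (suc (suc b)) (suc j) = Maybe.map suc (step (suc b) j)

pathEnd : ∀ {a b} → Fin a → Bool → CVertex a b
pathEnd i false = t i
pathEnd i true  = t (next i)

pv : ∀ {a b} → Fin a → Bool → Fin (suc b) → CVertex a b
pv i κ zero = s i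
pv {b = b} i κ (suc j) = maybe′ (mid {b = b} i κ) (pathEnd {b = b} i κ) (step b j)

Cab : ℕ → ℕ → Quiver
Cab a b = record
  { V   = CVertex a b
  ; E   = Fin a × Bool × Fin b
  ; src = λ { (i , κ , k) → pv i κ (inject₁ k) }
  ; tgt = λ { (i , κ , k) → pv i κ (suc k) }
  }

-- Let A be a minimal vertex set with few out-neighbours outside. By Menger's theorem any few vertices
-- of A can be linked to the boundary of A while avoiding a small set W. Inside A, a chain of a - 1
-- sources of size O(ab) exists: pack disjoint spiders (a centre with arms of length b), let every vertex
-- outside the packing choose an out-neighbour closer to the packing so that few of the walks leaving the
-- arms merge, and extract a subgraph of large minimum degree from the bipartite graph between arms and
-- roots of the resulting forest. The chain is closed up through one more spider: given linkages L from
-- the two ends of the chain and M from three arms of the spider to the boundary of A, avoiding the chain,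
-- following paths up to first intersections yields two disjoint meetings of L with different arms.

module Submission where

open import Data.Nat using (ℕ; zero; suc; _+_; _*_; _∸_; _^_; _≤_; _<_; z≤n; s≤s; _≤?_; _<?_; >-nonZero)
import Data.Nat as ℕ
open import Data.Nat.Properties hiding (_≟_)
open import Data.Nat.DivMod using (_%_; m<n⇒m%n≡m; n%n≡0)
open import Data.Nat.ListAction using (sum)
open import Data.Nat.Tactic.RingSolver using (solve-∀)
open import Data.Fin using (Fin; zero; suc; toℕ; fromℕ; inject₁; inject≤; punchOut)
import Data.Fin.Properties as Fin
open import Data.Fin.Relation.Unary.Top using (view; ‵fromℕ; ‵inject₁)
import Data.Fin.Subset as Subset
import Data.Fin.Subset.Properties as Subset
open import Data.Bool using (Bool; true; false; not; T)
import Data.Bool.Properties as Bool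
open import Data.List using (List; []; _∷_; _++_; length; map; filter; allFin; take; lookup; cartesianProduct; concatMap)
open import Data.List.Properties using (length-++; length-map; length-take; length-tabulate; filter-all; filter-notAll)
open import Data.List.Membership.Propositional using (_∈_; _∉_; find; lose)
open import Data.List.Membership.Propositional.Properties
open import Data.List.Relation.Unary.Any using (here; there; any?; index; toSum)
open import Data.List.Relation.Unary.Any.Properties using (lookup-index; ¬Any[])
import Data.List.Relation.Unary.All as All
open import Data.List.Relation.Unary.AllPairs using ([]; _∷_)
open import Data.List.Relation.Unary.Unique.Propositional using (Unique)
import Data.List.Relation.Unary.Unique.Propositional.Properties as Uniq
open import Data.Maybe using (just; nothing)
import Data.Maybe as Maybe
open import Data.Product using (Σ; ∃; _×_; _,_; proj₁; proj₂; map₁; map₂)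
import Data.Product.Properties as Product
open import Data.Sum using (_⊎_; inj₁; inj₂; [_,_]′)
open import Data.Vec using (tabulate)
open import Data.Vec.Properties using (lookup∘tabulate; lookup⇒[]=; []=⇒lookup)
open import Data.Empty using (⊥; ⊥-elim)
open import Function using (_∘_; id)
open import Relation.Nullary using (¬_; Dec; yes; no; ¬?; _×-dec_; _⊎-dec_; does)
open import Relation.Nullary.Decidable using (T?; dec-true)
import Relation.Nullary.Decidable as Dec
open import Relation.Unary using (Decidable)
open import Relation.Binary using (DecidableEquality; tri<; tri≈; tri>)
open import Relation.Binary.PropositionalEquality hiding (J)

-- Finite sets as duplicate-free lists

-- Large out-degree gives no control over in-degrees, so prescribed vertex sets cannot simply be
-- linked to each other. The boundary of `A` replaces such a link: it has fewer than `k` vertices,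
-- so two linkages into it with nearly `k` paths each must share most of their ends. Let `w` bound
-- `W`, and let `r₂`, `r₃` count the paths per end of the chain and per arm of the closing spider.
-- Menger's theorem asks for `2 r₂ + w ≤ k` and `3 r₃ + w ≤ k`, the count of common ends for
-- `k ≤ r₂ + 2 r₃`; together these force `k ≥ 7 w`. With two arms in place of three the last
-- condition would become `k ≤ r₂ + r₃ ≤ k - w`, which is impossible. In the chain, the obstacle is
-- that walks leaving one arm may merge and end in too few distinct roots. A vertex is therefore
-- given the value `K₂ - d * rank`, where `d` bounds the number of walks per arm: a move to smaller
-- rank gains at least `d`, and on average over the possible moves this gain outweighs the loss by
-- merging.

_⊑_ : {A : Set} → List A → List A → Set
xs ⊑ ys = ∀ {z} → z ∈ xs → z ∈ ys

_∥_ : {A : Set} → List A → List A → Set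
xs ∥ ys = ∀ {z} → z ∈ xs → z ∈ ys → ⊥

head-∉ : {A : Set} {x : A} {xs : List A} → Unique (x ∷ xs) → x ∉ xs
head-∉ (x≢ ∷ _) x∈ = All.lookup x≢ x∈ refl

unique-∷ : {A : Set} {x : A} {xs : List A} → x ∉ xs → Unique xs → Unique (x ∷ xs)
unique-∷ x∉ u = All.tabulate (λ y∈ eq → x∉ (subst (_∈ _) (sym eq) y∈)) ∷ u

unique-⊑⇒length≤ : {A : Set} {xs ys : List A} → Unique xs → xs ⊑ ys → length xs ≤ length ys
unique-⊑⇒length≤ {xs = []} _ _ = z≤n
unique-⊑⇒length≤ {xs = x ∷ xs} u@(_ ∷ u′) sub with ∈-∃++ (sub (here refl))
... | as , bs , refl =
  ≤-trans (s≤s (unique-⊑⇒length≤ u′ sub′))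
    (≤-reflexive (trans (cong suc (length-++ as)) (trans (sym (+-suc _ _)) (sym (length-++ as)))))
  where
  sub′ : xs ⊑ (as ++ bs)
  sub′ {z} z∈ with ∈-++⁻ as (sub (there z∈))
  ... | inj₁ p = ∈-++⁺ˡ p
  ... | inj₂ (here refl) = ⊥-elim (head-∉ u z∈)
  ... | inj₂ (there p) = ∈-++⁺ʳ as p

unique-map : {A B : Set} {f : A → B} {xs : List A} → Unique xs →
  (∀ {x y} → x ∈ xs → y ∈ xs → f x ≡ f y → x ≡ y) → Unique (map f xs)
unique-map {xs = []} _ _ = []
unique-map {f = f} {xs = x ∷ xs} u@(_ ∷ u′) inj =
  unique-∷ (λ fx∈ → let (y , y∈ , eq) = ∈-map⁻ f fx∈ in
              head-∉ u (subst (_∈ xs) (sym (inj (here refl) (there y∈) eq)) y∈))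
           (unique-map u′ (λ p q → inj (there p) (there q)))

length-filter-partition : {A : Set} {P : A → Set} (P? : Decidable P) (xs : List A) →
  length (filter P? xs) + length (filter (¬? ∘ P?) xs) ≡ length xs
length-filter-partition P? [] = refl
length-filter-partition P? (x ∷ xs) with P? x
... | yes _ = cong suc (length-filter-partition P? xs)
... | no _ = trans (+-suc _ _) (cong suc (length-filter-partition P? xs))

module _ {A : Set} (_≟_ : DecidableEquality A) where

  open import Data.List.Membership.DecPropositional _≟_ using (_∈?_)

  pick : ∀ {xs ys} → Unique xs → length ys < length xs → ∃ λ x → x ∈ xs × x ∉ ys
  pick {xs} {ys} u lt with any? (λ x → ¬? (x ∈? ys)) xs
  ... | yes p = find p
  ... | no ¬p = ⊥-elim (<⇒≱ lt (unique-⊑⇒length≤ u sub))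
    where
    sub : xs ⊑ ys
    sub {z} z∈ with z ∈? ys
    ... | yes q = q
    ... | no q = ⊥-elim (¬p (lose z∈ q))

  without : List A → List A → List A
  without ys xs = filter (λ x → ¬? (x ∈? ys)) xs

  length-without : ∀ {xs} ys → Unique xs → length xs ≤ length ys + length (without ys xs)
  length-without {xs} ys u = begin
    length xs ≡⟨ length-filter-partition (_∈? ys) xs ⟨
    length (filter (_∈? ys) xs) + length (without ys xs)
      ≤⟨ +-monoˡ-≤ _ (unique-⊑⇒length≤ (Uniq.filter⁺ (_∈? ys) u) (proj₂ ∘ ∈-filter⁻ (_∈? ys) {xs = xs})) ⟩
    length ys + length (without ys xs) ∎
    where open ≤-Reasoning

  pickMany : ∀ {xs} ys k → Unique xs → length ys + k ≤ length xs →
    ∃ λ zs → Unique zs × length zs ≡ k × zs ⊑ xs × zs ∥ ys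
  pickMany {xs} ys k u le =
      take k ws
    , Uniq.take⁺ k (Uniq.filter⁺ _ u)
    , trans (length-take k ws) (m≤n⇒m⊓n≡m (+-cancelˡ-≤ (length ys) _ _ (≤-trans le (length-without ys u))))
    , (λ z∈ → proj₁ (mem (take⊑ k z∈)))
    , (λ z∈ z∈ys → proj₂ (mem (take⊑ k z∈)) z∈ys)
    where
    ws = without ys xs
    mem : ∀ {z} → z ∈ ws → z ∈ xs × z ∉ ys
    mem = ∈-filter⁻ (λ x → ¬? (x ∈? ys)) {xs = xs}
    take⊑ : ∀ k {ws : List A} → take k ws ⊑ ws
    take⊑ (suc k) {_ ∷ _} (here p) = here p
    take⊑ (suc k) {_ ∷ _} (there p) = there (take⊑ k p)

-- Walks

data Walk {V : Set} (E : V → V → Set) : V → V → List V → Set where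
  []  : ∀ {u} → Walk E u u (u ∷ [])
  _∷_ : ∀ {u v w xs} → E u v → Walk E v w xs → Walk E u w (u ∷ xs)

module _ {V : Set} {E : V → V → Set} where

  walk-src : ∀ {u v xs} → Walk E u v xs → u ∈ xs
  walk-src [] = here refl
  walk-src (_ ∷ _) = here refl

  walk-dst : ∀ {u v xs} → Walk E u v xs → v ∈ xs
  walk-dst [] = here refl
  walk-dst (_ ∷ p) = there (walk-dst p)

  walk-map : ∀ {F : V → V → Set} {u v xs} → Walk E u v xs →
    (∀ {x y} → x ∈ xs → y ∈ xs → E x y → F x y) → Walk F u v xs
  walk-map [] f = []
  walk-map (e ∷ p) f = f (here refl) (there (walk-src p)) e ∷ walk-map p (λ x y → f (there x) (there y))

  -- The second list omits its first vertex, which the first list already contains.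
  walk-++ : ∀ {u v w xs ys} → Walk E u v xs → Walk E v w (v ∷ ys) → Walk E u w (xs ++ ys)
  walk-++ [] q = q
  walk-++ (e ∷ p) q = e ∷ walk-++ p q

  walk-glue : ∀ {u v w xs ys} → Walk E u v xs → Walk E v w ys →
    ∃ λ zs → Walk E u w zs × (∀ {z} → z ∈ zs → z ∈ xs ⊎ z ∈ ys)
  walk-glue {xs = xs} p [] = xs , p , inj₁
  walk-glue {xs = xs} p q@(_∷_ {xs = ys} _ _) =
    xs ++ ys , walk-++ p q , λ z∈ → [ inj₁ , inj₂ ∘ there ]′ (∈-++⁻ xs z∈)

  walk-join : ∀ {u v v′ w xs ys} → Walk E u v xs → E v v′ → Walk E v′ w ys → Walk E u w (xs ++ ys)
  walk-join [] e q = e ∷ q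
  walk-join (e′ ∷ p) e q = e′ ∷ walk-join p e q

  -- `pre` ends with `mid` and `post` omits it, so `xs` is literally `pre ++ post` and uniqueness
  -- passes to both parts. This is why `only` concludes with an equation to `mid` and not with a
  -- contradiction.
  record Cut (u w : V) (xs : List V) (P : V → Set) : Set where
    constructor mkCut
    field
      {mid}  : V
      pre    : List V
      post   : List V
      before : Walk E u mid pre
      after  : Walk E mid w (mid ∷ post)
      split  : xs ≡ pre ++ post
      hit    : P mid
      only   : ∀ {z} → z ∈ pre → P z → z ≡ mid

    pre⊑ : pre ⊑ xs
    pre⊑ z∈ = subst (_ ∈_) (sym split) (∈-++⁺ˡ z∈)

    after⊑ : (mid ∷ post) ⊑ xs
    after⊑ (here refl) = pre⊑ (walk-dst before)
    after⊑ (there z∈) = subst (_ ∈_) (sym split) (∈-++⁺ʳ pre z∈)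

    pre-unique : Unique xs → Unique pre
    pre-unique u = go pre (subst Unique split u)
      where
      go : ∀ as {bs : List V} → Unique (as ++ bs) → Unique as
      go [] _ = []
      go (a ∷ as) u@(_ ∷ u′) = unique-∷ (λ a∈ → head-∉ u (∈-++⁺ˡ a∈)) (go as u′)

    disjoint : Unique xs → pre ∥ post
    disjoint u = go pre (subst Unique split u)
      where
      go : ∀ as {bs : List V} → Unique (as ++ bs) → as ∥ bs
      go (a ∷ as) u (here refl) z∈ = head-∉ u (∈-++⁺ʳ as z∈)
      go (a ∷ as) (_ ∷ u) (there p) z∈ = go as u p z∈

    after-unique : Unique xs → Unique (mid ∷ post)
    after-unique u = unique-∷ (disjoint u (walk-dst before)) (go pre (subst Unique split u))
      where
      go : ∀ as {bs : List V} → Unique (as ++ bs) → Unique bs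
      go [] u = u
      go (a ∷ as) (_ ∷ u′) = go as u′

  upTo : ∀ {u w xs z} (C : Cut u w xs (_≡ z)) → Walk E u z (Cut.pre C)
  upTo (mkCut _ _ p _ _ refl _) = p

  firstHit : ∀ {P : V → Set} → Decidable P → ∀ {u w xs} → Walk E u w xs →
    (∃ λ z → z ∈ xs × P z) → Cut u w xs P
  firstHit P? {u} p h with P? u
  ... | yes Pu = trivial p
    where
    trivial : ∀ {xs w} → Walk E u w xs → Cut u w xs _
    trivial [] = mkCut (u ∷ []) [] [] [] refl Pu (λ { (here eq) _ → eq })
    trivial q@(_ ∷ _) = mkCut (u ∷ []) _ [] q refl Pu (λ { (here eq) _ → eq })
  firstHit P? [] (_ , here refl , Pz) | no ¬Pu = ⊥-elim (¬Pu Pz)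
  firstHit P? (_ ∷ _) (_ , here refl , Pz) | no ¬Pu = ⊥-elim (¬Pu Pz)
  firstHit P? (e ∷ p) (z , there z∈ , Pz) | no ¬Pu =
    mkCut (_ ∷ C.pre) C.post (e ∷ C.before) C.after (cong (_ ∷_) C.split) C.hit
      (λ { (here refl) Pz → ⊥-elim (¬Pu Pz) ; (there q) → C.only q })
    where module C = Cut (firstHit P? p (z , z∈ , Pz))

  module _ (_≟_ : DecidableEquality V) where

    open import Data.List.Membership.DecPropositional _≟_ using (_∈?_)

    splitAt∈ : ∀ {u w xs z} → Walk E u w xs → z ∈ xs → Cut u w xs (_≡ z)
    splitAt∈ {z = z} p z∈ = firstHit (_≟ z) p (z , z∈ , refl)

    shortcut : ∀ {u w xs} → Walk E u w xs → ∃ λ ys → Walk E u w ys × Unique ys × ys ⊑ xs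
    shortcut [] = _ , [] , unique-∷ (λ ()) [] , id
    shortcut {u} (e ∷ p) with shortcut p
    ... | ys , q , un , sub with u ∈? ys
    ... | no u∉ = u ∷ ys , e ∷ q , unique-∷ u∉ un , λ { (here eq) → here eq ; (there z∈) → there (sub z∈) }
    ... | yes u∈ with splitAt∈ q u∈
    ... | C@(mkCut pre post _ q′ _ refl _) = _ , q′ , Cut.after-unique C un , λ z∈ → there (sub (Cut.after⊑ C z∈))

-- Menger's theorem

injective⇒surjective : ∀ {k} (f : Fin k → Fin k) → (∀ {i j} → f i ≡ f j → i ≡ j) → ∀ c → ∃ λ i → f i ≡ c
injective⇒surjective {suc k} f inj c with Fin.any? (λ i → f i Fin.≟ c)
... | yes p = p
... | no ¬p = ⊥-elim (<⇒≱ ≤-refl (Fin.injective⇒≤ {f = g} g-inj))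
  where
  g : Fin (suc k) → Fin k
  g i = punchOut {i = c} (λ eq → ¬p (i , sym eq))
  g-inj : ∀ {i j} → g i ≡ g j → i ≡ j
  g-inj {i} {j} eq = inj (Fin.punchOut-injective (λ e → ¬p (i , sym e)) (λ e → ¬p (j , sym e)) eq)

module Menger {n : ℕ} where

  V : Set
  V = Fin n

  open import Data.List.Membership.DecPropositional (Fin._≟_ {n}) using (_∈?_)

  Arcs : List (V × V) → V → V → Set
  Arcs E u v = (u , v) ∈ E

  record Linkage (E : V → V → Set) (A B : List V) (k : ℕ) : Set where
    field
      src dst : Fin k → V
      vs      : Fin k → List V
      walk    : ∀ i → Walk E (src i) (dst i) (vs i)
      unique  : ∀ i → Unique (vs i)
      src∈    : ∀ i → src i ∈ A
      dst∈    : ∀ i → dst i ∈ B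
      apart   : ∀ {i j v} → v ∈ vs i → v ∈ vs j → i ≡ j

  Separates : (V → V → Set) → List V → List V → List V → Set
  Separates E A B S = ∀ {u v xs} → u ∈ A → v ∈ B → Walk E u v xs → ∃ λ z → z ∈ xs × z ∈ S

  Separator : (V → V → Set) → List V → List V → ℕ → Set
  Separator E A B k = ∃ λ S → length S < k × Separates E A B S

  lookup-injective : ∀ {xs : List V} → Unique xs → ∀ {i j} → lookup xs i ≡ lookup xs j → i ≡ j
  lookup-injective {_ ∷ _} u {zero} {zero} _ = refl
  lookup-injective {_ ∷ xs} u {zero} {suc j} eq = ⊥-elim (head-∉ u (subst (_∈ xs) (sym eq) (∈-lookup j)))
  lookup-injective {_ ∷ xs} u {suc i} {zero} eq = ⊥-elim (head-∉ u (subst (_∈ xs) eq (∈-lookup i)))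
  lookup-injective {_ ∷ _} (_ ∷ u) {suc i} {suc j} eq = cong suc (lookup-injective u eq)

  private
    trivialLinkage : ∀ {E A B} (C : List V) → Unique C → C ⊑ A → C ⊑ B → ∀ {k} → k ≤ length C → Linkage E A B k
    trivialLinkage C u CA CB k≤ = record
      { src = at ; dst = at ; vs = λ i → at i ∷ [] ; walk = λ _ → [] ; unique = λ _ → unique-∷ (λ ()) []
      ; src∈ = λ i → CA (∈-lookup _) ; dst∈ = λ i → CB (∈-lookup _)
      ; apart = λ { (here refl) (here eq) → Fin.inject≤-injective _ _ _ _ (lookup-injective u eq) } }
      where
      at = λ i → lookup C (inject≤ i k≤)

    -- Glues a linkage into x ∷ S with one out of y ∷ S, for S separating A from B and (x , y) a new arc:
    -- the paths can only meet in S, because elsewhere they would form an S-avoiding walk.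
    module Glue (E : List (V × V)) (A B S : List V) (x y : V)
      (sep : Separates (Arcs E) A B S)
      (P : Linkage (Arcs E) A (x ∷ S) (suc (length S))) (Q : Linkage (Arcs E) (y ∷ S) B (suc (length S))) where

      module P = Linkage P
      module Q = Linkage Q

      α β : Fin (suc (length S)) → Fin (suc (length S))
      α i = index (P.dst∈ i)
      β j = index (Q.src∈ j)

      dst≡ : ∀ i → P.dst i ≡ lookup (x ∷ S) (α i)
      dst≡ i = lookup-index (P.dst∈ i)
      src≡ : ∀ j → Q.src j ≡ lookup (y ∷ S) (β j)
      src≡ j = lookup-index (Q.src∈ j)

      α-inj : ∀ {i j} → α i ≡ α j → i ≡ j
      α-inj {i} {j} eq = P.apart (walk-dst (P.walk i))
        (subst (_∈ P.vs j) (trans (dst≡ j) (trans (cong (lookup (x ∷ S)) (sym eq)) (sym (dst≡ i)))) (walk-dst (P.walk j)))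
      β-inj : ∀ {i j} → β i ≡ β j → i ≡ j
      β-inj {i} {j} eq = Q.apart (walk-src (Q.walk i))
        (subst (_∈ Q.vs j) (trans (src≡ j) (trans (cong (lookup (y ∷ S)) (sym eq)) (sym (src≡ i)))) (walk-src (Q.walk j)))

      -- Ends of `P` and starts of `Q` are matched by index: index zero is `x` on one side and `y`
      -- on the other, to be bridged by the new arc; every other index is the same vertex of `S` on
      -- both sides.
      γ : Fin (suc (length S)) → Fin (suc (length S))
      γ i = proj₁ (injective⇒surjective β β-inj (α i))
      βγ : ∀ i → β (γ i) ≡ α i
      βγ i = proj₂ (injective⇒surjective β β-inj (α i))
      γ-inj : ∀ {i j} → γ i ≡ γ j → i ≡ j
      γ-inj {i} {j} eq = α-inj (trans (sym (βγ i)) (trans (cong β eq) (βγ j)))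

      -- There are as many disjoint paths as entries in `x ∷ S`, so each vertex of `S` is already
      -- the end of some path, and disjointness keeps it off the rest.
      onlyDst : ∀ {i z} → z ∈ P.vs i → z ∈ S → z ≡ P.dst i
      onlyDst {i} {z} z∈ zS with injective⇒surjective α α-inj (suc (index zS))
      ... | j , eq = subst (λ l → z ≡ P.dst l) (P.apart (subst (_∈ P.vs j) (sym z≡) (walk-dst (P.walk j))) z∈) z≡
        where
        z≡ : z ≡ P.dst j
        z≡ = trans (lookup-index zS) (trans (cong (lookup (x ∷ S)) (sym eq)) (sym (dst≡ j)))

      onlySrc : ∀ {i z} → z ∈ Q.vs i → z ∈ S → z ≡ Q.src i
      onlySrc {i} {z} z∈ zS with injective⇒surjective β β-inj (suc (index zS))
      ... | j , eq = subst (λ l → z ≡ Q.src l) (Q.apart (subst (_∈ Q.vs j) (sym z≡) (walk-src (Q.walk j))) z∈) z≡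
        where
        z≡ : z ≡ Q.src j
        z≡ = trans (lookup-index zS) (trans (cong (lookup (y ∷ S)) (sym eq)) (sym (src≡ j)))

      dst-in-S : ∀ i j → P.dst i ∈ S → P.dst i ∈ Q.vs j → j ≡ γ i
      dst-in-S i j d∈ q∈ = β-inj (trans eq (sym (βγ i)))
        where
        jS : ∃ λ l → β l ≡ suc (index d∈)
        jS = injective⇒surjective β β-inj (suc (index d∈))
        iS : ∃ λ l → α l ≡ suc (index d∈)
        iS = injective⇒surjective α α-inj (suc (index d∈))
        i≡ : proj₁ iS ≡ i
        i≡ = P.apart (walk-dst (P.walk (proj₁ iS)))
          (subst (_∈ P.vs i) (trans (lookup-index d∈) (trans (cong (lookup (x ∷ S)) (sym (proj₂ iS))) (sym (dst≡ (proj₁ iS)))))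
            (walk-dst (P.walk i)))
        j≡ : proj₁ jS ≡ j
        j≡ = Q.apart (walk-src (Q.walk (proj₁ jS)))
          (subst (_∈ Q.vs j) (trans (lookup-index d∈) (trans (cong (lookup (y ∷ S)) (sym (proj₂ jS))) (sym (src≡ (proj₁ jS)))))
            q∈)
        eq : β j ≡ α i
        eq = trans (cong β (sym j≡)) (trans (proj₂ jS) (trans (sym (proj₂ iS)) (cong α i≡)))

      meet : ∀ i j {v} → v ∈ P.vs i → v ∈ Q.vs j → j ≡ γ i
      meet i j {v} p∈ q∈ with splitAt∈ Fin._≟_ (P.walk i) p∈ | splitAt∈ Fin._≟_ (Q.walk j) q∈
      ... | C₁@(mkCut pre _ w₁ _ _ refl _) | C₂@(mkCut _ post _ w₂ _ refl _)
        with walk-glue w₁ w₂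
      ... | zs , w , sub with sep (P.src∈ i) (Q.dst∈ j) w
      ... | h , h∈ , hS with sub h∈
      ... | inj₁ h∈pre = dst-in-S i j (subst (_∈ S) h≡ hS) (subst (_∈ Q.vs j) v≡ q∈)
        where
        h≡ : h ≡ P.dst i
        h≡ = onlyDst (Cut.pre⊑ C₁ h∈pre) hS
        v≡ : v ≡ P.dst i
        v≡ with walk-dst (Cut.after C₁)
        ... | here eq = sym eq
        ... | there d∈ = ⊥-elim (Cut.disjoint C₁ (P.unique i) (subst (_∈ pre) h≡ h∈pre) d∈)
      ... | inj₂ h∈post = dst-in-S i j (subst (_∈ S) d≡ hS) (subst (_∈ Q.vs j) d≡ (Cut.after⊑ C₂ h∈post))
        where
        h≡ : h ≡ Q.src j
        h≡ = onlySrc (Cut.after⊑ C₂ h∈post) hS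
        h≡v : h ≡ v
        h≡v = [ id , (λ q → ⊥-elim (Cut.disjoint C₂ (Q.unique j) (walk-src (Cut.before C₂)) (subst (_∈ post) h≡ q))) ]′
          (toSum h∈post)
        d≡ : h ≡ P.dst i
        d≡ = onlyDst (subst (_∈ P.vs i) (sym h≡v) p∈) hS

      E′ : V → V → Set
      E′ = Arcs ((x , y) ∷ E)

      connect : ∀ c d → d ≡ c → ∀ {s t u v xs ys} → t ≡ lookup (x ∷ S) c → u ≡ lookup (y ∷ S) d →
        Walk E′ s t xs → Walk E′ u v ys → ∃ λ zs → Walk E′ s v zs × (∀ {z} → z ∈ zs → z ∈ xs ⊎ z ∈ ys)
      connect zero .zero refl {xs = xs} refl refl p q = _ , walk-join p (here refl) q , ∈-++⁻ xs
      connect (suc c) .(suc c) refl refl refl p q = walk-glue p q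

      glued : ∀ i → ∃ λ zs → Walk E′ (P.src i) (Q.dst (γ i)) zs × Unique zs ×
        (∀ {z} → z ∈ zs → z ∈ P.vs i ⊎ z ∈ Q.vs (γ i))
      -- `meet` restricts which two paths can share a vertex, not where they share it, so
      -- repetitions in the concatenation are removed by shortcutting.
      glued i = let (zs , w , sub) = long ; (ys , w′ , un , sub′) = shortcut Fin._≟_ w in ys , w′ , un , (sub ∘ sub′)
        where
        long : ∃ λ zs → Walk E′ (P.src i) (Q.dst (γ i)) zs × (∀ {z} → z ∈ zs → z ∈ P.vs i ⊎ z ∈ Q.vs (γ i))
        long = connect (α i) (β (γ i)) (βγ i) (dst≡ i) (src≡ (γ i))
          (walk-map (P.walk i) (λ _ _ → there)) (walk-map (Q.walk (γ i)) (λ _ _ → there))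

      linkage : Linkage E′ A B (suc (length S))
      linkage = record
        { src = P.src ; dst = Q.dst ∘ γ ; vs = proj₁ ∘ glued
        ; walk = λ i → proj₁ (proj₂ (glued i)) ; unique = λ i → proj₁ (proj₂ (proj₂ (glued i)))
        ; src∈ = P.src∈ ; dst∈ = Q.dst∈ ∘ γ
        ; apart = λ {i} {j} p q → disj (proj₂ (proj₂ (proj₂ (glued i))) p) (proj₂ (proj₂ (proj₂ (glued j))) q) }
        where
        disj : ∀ {i j v} → v ∈ P.vs i ⊎ v ∈ Q.vs (γ i) → v ∈ P.vs j ⊎ v ∈ Q.vs (γ j) → i ≡ j
        disj (inj₁ p) (inj₁ q) = P.apart p q
        disj {i} {j} (inj₁ p) (inj₂ q) = sym (γ-inj (meet i (γ j) p q))
        disj {i} {j} (inj₂ p) (inj₁ q) = γ-inj (meet j (γ i) q p)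
        disj (inj₂ p) (inj₂ q) = γ-inj (Q.apart p q)

    decompose : ∀ E {x y u v xs} → Walk (Arcs ((x , y) ∷ E)) u v xs →
      Walk (Arcs E) u v xs ⊎
      (∃ λ ys → Walk (Arcs E) u x ys × ys ⊑ xs) × (∃ λ ys → Walk (Arcs E) y v ys × ys ⊑ xs)
    decompose E [] = inj₁ []
    decompose E {x} {y} (e ∷ p) with decompose E p | e
    ... | inj₁ q | here refl = inj₂ ((x ∷ [] , [] , λ { (here eq) → here eq }) , (_ , q , there))
    ... | inj₁ q | there e′ = inj₁ (e′ ∷ q)
    ... | inj₂ (_ , (ys , q , sub)) | here refl =
      inj₂ ((x ∷ [] , [] , λ { (here eq) → here eq }) , (ys , q , there ∘ sub))
    ... | inj₂ ((zs , r , sub′) , (ys , q , sub)) | there e′ =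
      inj₂ ((_ , e′ ∷ r , λ { (here eq) → here eq ; (there z∈) → there (sub′ z∈) }) , (ys , q , there ∘ sub))

  -- Induction on the arcs, after Göring. With no arcs every walk is a single vertex, and the
  -- intersection of `A` and `B` serves as linkage or as separator. When an arc `(x , y)` joins a
  -- graph separated by `S`, the list `x ∷ S` still separates. This settles everything except
  -- `length S ≡ k - 1`, where the old arcs must link `A` to `x ∷ S` and `y ∷ S` to `B`.
  menger : ∀ E A B k → Separator (Arcs E) A B k ⊎ Linkage (Arcs E) A B k
  menger [] A B k with k ≤? length C
    where C = filter (_∈? B) (filter (_∈? A) (allFin n))
  ... | yes k≤ = inj₂ (trivialLinkage _ (Uniq.filter⁺ _ (Uniq.filter⁺ _ (Uniq.allFin⁺ n)))
                   (λ z∈ → proj₂ (∈-filter⁻ (_∈? A) {xs = allFin n} (proj₁ (∈-filter⁻ (_∈? B) {xs = filter (_∈? A) (allFin n)} z∈))))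
                   (λ z∈ → proj₂ (∈-filter⁻ (_∈? B) {xs = filter (_∈? A) (allFin n)} z∈)) k≤)
  ... | no k≰ = inj₁ (_ , ≰⇒> k≰ ,
      λ { u∈ v∈ [] → _ , here refl , ∈-filter⁺ (_∈? B) (∈-filter⁺ (_∈? A) (∈-allFin _) u∈) v∈ })
  menger ((x , y) ∷ E) A B k with menger E A B k
  ... | inj₂ L = inj₂ record
    { src = L.src ; dst = L.dst ; vs = L.vs ; walk = λ i → walk-map (L.walk i) (λ _ _ → there)
    ; unique = L.unique ; src∈ = L.src∈ ; dst∈ = L.dst∈ ; apart = L.apart }
    where module L = Linkage L
  ... | inj₁ (S , S<k , sep) with suc (length S) <? k
  ... | yes S′<k = inj₁ (x ∷ S , S′<k , sep′)
    where
    sep′ : Separates (Arcs ((x , y) ∷ E)) A B (x ∷ S)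
    sep′ u∈ v∈ w with decompose E w
    ... | inj₁ w′ = let (z , z∈ , zS) = sep u∈ v∈ w′ in z , z∈ , there zS
    ... | inj₂ ((_ , w′ , sub) , _) = x , sub (walk-dst w′) , here refl
  ... | no S′≮k with ≤-antisym S<k (≮⇒≥ S′≮k)
  ... | refl with menger E A (x ∷ S) (suc (length S)) | menger E (y ∷ S) B (suc (length S))
  -- `R` separates `A` from `B` even with the new arc: a walk using that arc first reaches `x`, any
  -- other walk reaches `S`, and `R` is met on the way.
  ... | inj₁ (R , R<k , sepR) | _ = inj₁ (R , R<k , sep′)
    where
    sep′ : Separates (Arcs ((x , y) ∷ E)) A B R
    sep′ u∈ v∈ w with decompose E w
    ... | inj₂ ((_ , w′ , sub) , _) = let (z , z∈ , zR) = sepR u∈ (here refl) w′ in z , sub z∈ , zR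
    ... | inj₁ w′ with sep u∈ v∈ w′
    ... | z , z∈ , zS with splitAt∈ Fin._≟_ w′ z∈
    ... | C@(mkCut _ _ w″ _ _ refl _) = let (t , t∈ , tR) = sepR u∈ (there zS) w″ in t , Cut.pre⊑ C t∈ , tR
  ... | inj₂ _ | inj₁ (R , R<k , sepR) = inj₁ (R , R<k , sep′)
    where
    sep′ : Separates (Arcs ((x , y) ∷ E)) A B R
    sep′ u∈ v∈ w with decompose E w
    ... | inj₂ (_ , (_ , w′ , sub)) = let (z , z∈ , zR) = sepR (here refl) v∈ w′ in z , sub z∈ , zR
    ... | inj₁ w′ with sep u∈ v∈ w′
    ... | z , z∈ , zS with splitAt∈ Fin._≟_ w′ z∈
    ... | C@(mkCut _ _ _ w″ _ refl _) = let (t , t∈ , tR) = sepR (there zS) v∈ w″ in t , Cut.after⊑ C t∈ , tR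
  ... | inj₂ P | inj₂ Q = inj₂ (Glue.linkage E A B S x y sep P Q)

-- Reachable sets and a minimal set with small out-boundary

unique-length≤ : ∀ {n} {xs : List (Fin n)} → Unique xs → length xs ≤ n
unique-length≤ {n} {xs} u = subst (length xs ≤_) (length-tabulate id) (unique-⊑⇒length≤ u (λ _ → ∈-allFin _))

reachable : ∀ {n} {E : Fin n → Fin n → Set} → (∀ u v → Dec (E u v)) → ∀ z →
  ∃ λ X → z ∈ X × (∀ {v} → v ∈ X → ∃ λ xs → Walk E z v xs) × (∀ {u v} → u ∈ X → E u v → v ∈ X)
reachable {n} {E} E? z = grow n (z ∷ []) (unique-∷ (λ ()) []) (here refl) (m≤m+n n 1) (λ { (here refl) → _ , [] })
  where
  open import Data.List.Membership.DecPropositional (Fin._≟_ {n}) using (_∈?_)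
  grow : ∀ fuel X → Unique X → z ∈ X → n ≤ fuel + length X → (∀ {v} → v ∈ X → ∃ λ xs → Walk E z v xs) →
    ∃ λ X → z ∈ X × (∀ {v} → v ∈ X → ∃ λ xs → Walk E z v xs) × (∀ {u v} → u ∈ X → E u v → v ∈ X)
  grow fuel X uX z∈ le walks with any? (λ u → Fin.any? (λ v → E? u v ×-dec ¬? (v ∈? X))) X
  ... | no closed = X , z∈ , walks , closed′
    where
    closed′ : ∀ {u v} → u ∈ X → E u v → v ∈ X
    closed′ {u} {v} u∈ e with v ∈? X
    ... | yes v∈ = v∈
    ... | no v∉ = ⊥-elim (closed (lose u∈ (v , e , v∉)))
  ... | yes a with find a
  ... | u , u∈ , v , e , v∉ with fuel
  ... | zero = ⊥-elim (<⇒≱ (s≤s le) (unique-length≤ (unique-∷ v∉ uX)))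
  ... | suc fuel = grow fuel (v ∷ X) (unique-∷ v∉ uX) (there z∈) (subst (n ≤_) (sym (+-suc fuel _)) le)
      λ { (here refl) → _ , proj₁ (proj₂ (walk-glue (proj₂ (walks u∈)) (e ∷ [])))
        ; (there v∈) → walks v∈ }

module _ {n : ℕ} (adj : Fin n → Fin n → Bool) where

  Adj : Fin n → Fin n → Set
  Adj u v = T (adj u v)

  outs : Fin n → List (Fin n)
  outs v = filter (λ w → T? (adj v w)) (allFin n)

  outs-unique : ∀ v → Unique (outs v)
  outs-unique v = Uniq.filter⁺ _ (Uniq.allFin⁺ n)

  ∈-outs⁻ : ∀ {v w} → w ∈ outs v → Adj v w
  ∈-outs⁻ {v} = proj₂ ∘ ∈-filter⁻ (λ w → T? (adj v w)) {xs = allFin n}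

  -- `In` is the set `A` of the overview and `exits` its out-boundary. Minimality enters through
  -- `expanding`: for a nonempty part `X` of `In`, proper because of `z`, no `Y` with fewer than `k`
  -- vertices catches all arcs leaving `X`.
  record Trap (k : ℕ) : Set₁ where
    field
      In        : Fin n → Set
      In?       : ∀ v → Dec (In v)
      inside    : ∃ In
      exits     : List (Fin n)
      exits<    : length exits < k
      closed    : ∀ {u v} → In u → Adj u v → In v ⊎ v ∈ exits
      expanding : ∀ X Y {x z} → (∀ {u} → u ∈ X → In u) → x ∈ X → In z → z ∉ X →
                  (∀ {u v} → u ∈ X → Adj u v → v ∈ X ⊎ v ∈ Y) → k ≤ length Y

  -- The full vertex set has empty boundary, so the descent can start as soon as `0 < k`; it stops
  -- because each smaller set with small boundary has fewer elements.
  trap : ∀ {k} → 0 < k → 0 < n → Trap k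
  trap {k} 0<k 0<n = search n Subset.⊤ (Subset.∣p∣≤n Subset.⊤) (top 0<n)
      (≤-<-trans (unique-⊑⇒length≤ {ys = []} (boundary-unique Subset.⊤) λ z∈ → ⊥-elim (proj₁ (∈-boundary⁻ z∈) Subset.∈⊤)) 0<k)
    where
    open import Data.List.Membership.DecPropositional (Fin._≟_ {n}) using (_∈?_)

    top : ∀ {n} → 0 < n → Subset.Nonempty {n} Subset.⊤
    top {suc n} _ = zero , Subset.∈⊤

    Out : Subset.Subset n → Fin n → Set
    Out X v = v Subset.∉ X × ∃ λ u → u Subset.∈ X × Adj u v
    Out? : ∀ X v → Dec (Out X v)
    Out? X v = ¬? (v Subset.∈? X) ×-dec Fin.any? (λ u → (u Subset.∈? X) ×-dec T? (adj u v))
    boundary : Subset.Subset n → List (Fin n)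
    boundary X = filter (Out? X) (allFin n)
    boundary-unique : ∀ X → Unique (boundary X)
    boundary-unique X = Uniq.filter⁺ _ (Uniq.allFin⁺ n)
    ∈-boundary⁻ : ∀ {X v} → v ∈ boundary X → Out X v
    ∈-boundary⁻ {X} = proj₂ ∘ ∈-filter⁻ (Out? X) {xs = allFin n}
    ∈-boundary⁺ : ∀ {X v} → Out X v → v ∈ boundary X
    ∈-boundary⁺ {X} = ∈-filter⁺ (Out? X) (∈-allFin _)

    Smaller : Subset.Subset n → Subset.Subset n → Set
    Smaller A X = Subset.Nonempty X × X Subset.⊂ A × length (boundary X) < k

    search : ∀ m A → Subset.∣ A ∣ ≤ m → Subset.Nonempty A → length (boundary A) < k → Trap k
    search m A size ne small
      with Subset.anySubset? {P = Smaller A} (λ X → Subset.nonempty? X ×-dec (X Subset.⊂? A) ×-dec (_ <? k))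
    search m A size ne small | yes (X , neX , X⊂A , smallX) with m | ≤-trans (Subset.p⊂q⇒∣p∣<∣q∣ X⊂A) size
    ... | suc m | s≤s size′ = search m X size′ neX smallX
    search m A size ne small | no minimal = record
      { In = Subset._∈ A ; In? = Subset._∈? A ; inside = ne ; exits = boundary A ; exits< = small
      ; closed = λ {u} {v} u∈ e → closed {u} {v} u∈ e ; expanding = expanding }
      where
      closed : ∀ {u v} → u Subset.∈ A → Adj u v → v Subset.∈ A ⊎ v ∈ boundary A
      closed {u} {v} u∈ e with v Subset.∈? A
      ... | yes v∈ = inj₁ v∈
      ... | no v∉ = inj₂ (∈-boundary⁺ (v∉ , u , u∈ , e))
      expanding : ∀ X Y {x z} → (∀ {u} → u ∈ X → u Subset.∈ A) → x ∈ X → z Subset.∈ A → z ∉ X →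
                  (∀ {u v} → u ∈ X → Adj u v → v ∈ X ⊎ v ∈ Y) → k ≤ length Y
      expanding X Y {x} {z} X⊆A x∈ zA z∉ absorb with k ≤? length Y
      ... | yes p = p
      ... | no k≰ = ⊥-elim (minimal (S , (x , ∈S⁺ x∈) , ((X⊆A ∘ ∈S⁻) , z , zA , (z∉ ∘ ∈S⁻)) ,
              ≤-<-trans (unique-⊑⇒length≤ (boundary-unique S) sub) (≰⇒> k≰)))
        where
        S : Subset.Subset n
        S = tabulate (λ v → does (v ∈? X))
        ∈S⁺ : ∀ {v} → v ∈ X → v Subset.∈ S
        ∈S⁺ {v} v∈ = lookup⇒[]= v S (trans (lookup∘tabulate _ v) (dec-true (v ∈? X) v∈))
        ∈S⁻ : ∀ {v} → v Subset.∈ S → v ∈ X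
        ∈S⁻ {v} v∈ with v ∈? X | trans (sym (lookup∘tabulate (λ v → does (v ∈? X)) v)) ([]=⇒lookup v∈)
        ... | yes p | _ = p
        sub : boundary S ⊑ Y
        sub z∈ with ∈-boundary⁻ z∈
        ... | v∉ , u , u∈ , e with absorb (∈S⁻ u∈) e
        ... | inj₁ v∈ = ⊥-elim (v∉ (∈S⁺ v∈))
        ... | inj₂ v∈ = v∈

  Avoiding : List (Fin n) → Fin n → Fin n → Set
  Avoiding W u v = Adj u v × u ∉ W × v ∉ W

  module _ {k : ℕ} (trap : Trap k) where

    open Trap trap
    open import Data.List.Membership.DecPropositional (Fin._≟_ {n}) using (_∈?_)

    -- Otherwise fewer than `length Z` vertices `S` cut `Z` off the exits outside `W`. The set
    -- reached from some `z₀` of `Z` outside `S`, while avoiding `S` and `W`, never leaves `In`,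
    -- misses `z`, and sends its arcs only into itself, `S` or `W`. As `S ++ W` has fewer than `k`
    -- entries, this contradicts `expanding`.
    linkToExits : ∀ W Z {z} → z ∈ W → In z → Unique Z → Z ∥ W → (∀ {u} → u ∈ Z → In u ⊎ u ∈ exits) →
      length Z + length W ≤ k → Menger.Linkage (Avoiding W) Z exits (length Z)
    linkToExits W Z z∈W zIn uZ Z∥W Z⊆ le with Menger.menger arcs Z exits (length Z)
      where
      arcs = filter (λ { (u , v) → T? (adj u v) ×-dec ¬? (u ∈? W) ×-dec ¬? (v ∈? W) })
               (cartesianProduct (allFin n) (allFin n))
    ... | inj₂ L = record
      { src = L.src ; dst = L.dst ; vs = L.vs ; unique = L.unique ; src∈ = L.src∈ ; dst∈ = L.dst∈ ; apart = L.apart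
      ; walk = λ i → walk-map (L.walk i) (λ _ _ e → proj₂ (∈-filter⁻ _ {xs = cartesianProduct (allFin n) (allFin n)} e)) }
      where module L = Menger.Linkage L
    ... | inj₁ (S , S< , sep) = ⊥-elim (<⇒≱ (<-≤-trans S+W< le) k≤)
      where
      S+W< : length (S ++ W) < length Z + length W
      S+W< = subst (_< length Z + length W) (sym (length-++ S)) (+-monoˡ-< (length W) S<)
      start = pick Fin._≟_ uZ S<
      z₀ = proj₁ start
      z₀∈ = proj₁ (proj₂ start)
      z₀∉S = proj₂ (proj₂ start)
      E : Fin n → Fin n → Set
      E u v = Avoiding W u v × v ∉ S
      reach = reachable {E = E} (λ u v → (T? (adj u v) ×-dec ¬? (u ∈? W) ×-dec ¬? (v ∈? W)) ×-dec ¬? (v ∈? S)) z₀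
      X = proj₁ reach
      good : ∀ {u v xs} → Walk E u v xs → u ∉ S → u ∉ W → ∀ {x} → x ∈ xs → x ∉ S × x ∉ W
      good [] u∉S u∉W (here refl) = u∉S , u∉W
      good (_ ∷ _) u∉S u∉W (here refl) = u∉S , u∉W
      good (((_ , _ , v∉W) , v∉S) ∷ p) _ _ (there x∈) = good p v∉S v∉W x∈
      z₀∉W : z₀ ∉ W
      z₀∉W = Z∥W z₀∈
      noExit : ∀ {v xs} → Walk E z₀ v xs → v ∉ exits
      noExit p v∈ =
        let (s , s∈ , sS) = sep z₀∈ v∈ (walk-map p (λ _ _ e →
              ∈-filter⁺ _ (∈-cartesianProduct⁺ (∈-allFin _) (∈-allFin _)) (proj₁ e)))
        in proj₁ (good p z₀∉S z₀∉W s∈) sS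
      stays : ∀ {u v xs ys} → Walk E z₀ u ys → In u → Walk E u v xs → In v
      stays _ uIn [] = uIn
      stays q uIn (e ∷ p) with proj₁ (proj₂ (walk-glue q (e ∷ []))) | closed uIn (proj₁ (proj₁ e))
      ... | q′ | inj₁ vIn = stays q′ vIn p
      ... | q′ | inj₂ vX = ⊥-elim (noExit q′ vX)
      z₀In : In z₀
      z₀In with Z⊆ z₀∈
      ... | inj₁ p = p
      ... | inj₂ p = ⊥-elim (noExit [] p)
      walks = proj₁ (proj₂ (proj₂ reach))
      good′ : ∀ {v} → v ∈ X → v ∉ S × v ∉ W
      good′ v∈ = good (proj₂ (walks v∈)) z₀∉S z₀∉W (walk-dst (proj₂ (walks v∈)))
      absorb : ∀ {u v} → u ∈ X → Adj u v → v ∈ X ⊎ v ∈ S ++ W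
      absorb {u} {v} u∈ e with v ∈? S | v ∈? W
      ... | yes p | _ = inj₂ (∈-++⁺ˡ p)
      ... | no _ | yes p = inj₂ (∈-++⁺ʳ S p)
      ... | no v∉S | no v∉W = inj₁ (proj₂ (proj₂ (proj₂ reach)) u∈ ((e , proj₂ (good′ u∈) , v∉W) , v∉S))
      k≤ : k ≤ length (S ++ W)
      k≤ = expanding X (S ++ W) (λ v∈ → stays [] z₀In (proj₂ (walks v∈))) (proj₁ (proj₂ reach)) zIn
             (λ z∈X → proj₂ (good′ z∈X) z∈W) absorb

-- Spiders

-- The number three comes from the closing spider: which two of its arms are used is decided only by
-- `twoJoins`. Spiders of the chain use the arms named by `portArm`.
record Spider {n : ℕ} (adj : Fin n → Fin n → Bool) (b : ℕ) : Set where
  field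
    centre : Fin n
    arm    : Fin 3 → List (Fin n)
    end    : Fin 3 → Fin n
    walk   : ∀ κ → Walk (Adj adj) centre (end κ) (centre ∷ arm κ)
    unique : ∀ κ → Unique (centre ∷ arm κ)
    len    : ∀ κ → length (arm κ) ≡ b
    apart  : ∀ {κ ι v} → v ∈ arm κ → v ∈ arm ι → κ ≡ ι

  verts : List (Fin n)
  verts = centre ∷ arm zero ++ arm (suc zero) ++ arm (suc (suc zero))

  length-verts : length verts ≡ suc (b + (b + b))
  length-verts = cong suc (trans (length-++ (arm zero)) (cong₂ _+_ (len zero)
    (trans (length-++ (arm (suc zero))) (cong₂ _+_ (len (suc zero)) (len (suc (suc zero)))))))

  arm⊑verts : ∀ κ → arm κ ⊑ verts
  arm⊑verts zero v∈ = there (∈-++⁺ˡ v∈)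
  arm⊑verts (suc zero) v∈ = there (∈-++⁺ʳ (arm zero) (∈-++⁺ˡ v∈))
  arm⊑verts (suc (suc zero)) v∈ = there (∈-++⁺ʳ (arm zero) (∈-++⁺ʳ (arm (suc zero)) v∈))

  leg⊑verts : ∀ κ → (centre ∷ arm κ) ⊑ verts
  leg⊑verts κ (here eq) = here eq
  leg⊑verts κ (there v∈) = arm⊑verts κ v∈

  end∈verts : ∀ κ → end κ ∈ verts
  end∈verts κ = leg⊑verts κ (walk-dst (walk κ))

module _ {n : ℕ} (adj : Fin n → Fin n → Bool) where

  -- `H j v` grants `j` further steps from `v` with `δ` choices at each, so a walk can dodge any
  -- forbidden list that stays shorter than `δ`. The instances are the complements of the layers
  -- around a packing and, for the closing spider, the constant predicate `In`.
  module Greedy (H : ℕ → Fin n → Set) (δ : ℕ)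
    (descend : ∀ j v → H (suc j) v →
      ∃ λ N → Unique N × δ ≤ length N × (∀ {w} → w ∈ N → Adj adj v w × H j w))
    (Region : Fin n → Set) (H⊆ : ∀ {j v} → H j v → Region v) where

    greedyWalk : ∀ j r F → H j r → length F + j ≤ δ → r ∈ F →
      ∃ λ z → ∃ λ ws → Walk (Adj adj) r z (r ∷ ws) × Unique ws × ws ∥ F × length ws ≡ j ×
        (∀ {v} → v ∈ ws → Region v)
    greedyWalk zero r F h le r∈ = r , [] , [] , [] , (λ ()) , refl , λ ()
    greedyWalk (suc j) r F h le r∈ with descend j r h
    ... | N , uN , δ≤ , good
      with pick Fin._≟_ {ys = F} uN (<-≤-trans (<-≤-trans (m<m+n (length F) (s≤s z≤n)) le) δ≤)
    ... | v , v∈ , v∉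
      with greedyWalk j v (v ∷ F) (proj₂ (good v∈)) (subst (_≤ δ) (+-suc _ j) le) (here refl)
    ... | z , ws , p , u , avoid , len , reg =
        z , v ∷ ws , proj₁ (good v∈) ∷ p , unique-∷ (λ v∈ws → avoid v∈ws (here refl)) u
      , (λ { (here refl) q → v∉ q ; (there v∈) q → avoid v∈ (there q) })
      , cong suc len
      , λ { (here refl) → H⊆ (proj₂ (good v∈)) ; (there w∈) → reg w∈ }

    spider : ∀ b r F → H b r → r ∉ F → length F + suc (b + (b + b)) ≤ δ →
      ∃ λ (S : Spider adj b) → Spider.centre S ≡ r × (Spider.verts S ∥ F) ×
        (∀ {v} → v ∈ Spider.verts S → Region v)
    spider b r F h r∉ le = S , refl , avoidF , region
      where
      F₀ = r ∷ F
      size₀ : length F₀ + (b + (b + b)) ≤ δ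
      size₀ = subst (_≤ δ) (+-suc _ _) le
      a₀ = greedyWalk b r F₀ h (≤-trans (+-monoʳ-≤ _ (m≤m+n b _)) size₀) (here refl)
      ws₀ = proj₁ (proj₂ a₀)
      F₁ = ws₀ ++ F₀
      len₀ = proj₁ (proj₂ (proj₂ (proj₂ (proj₂ (proj₂ a₀)))))
      size₁ : length F₁ + (b + b) ≤ δ
      size₁ = begin
        length F₁ + (b + b) ≡⟨ cong (_+ (b + b)) (trans (length-++ ws₀) (trans (cong (_+ length F₀) len₀) (+-comm b _))) ⟩
        (length F₀ + b) + (b + b) ≡⟨ +-assoc (length F₀) b (b + b) ⟩
        length F₀ + (b + (b + b)) ≤⟨ size₀ ⟩
        δ ∎ where open ≤-Reasoning
      a₁ = greedyWalk b r F₁ h (≤-trans (+-monoʳ-≤ _ (m≤m+n b _)) size₁) (∈-++⁺ʳ ws₀ (here refl))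
      ws₁ = proj₁ (proj₂ a₁)
      F₂ = ws₁ ++ F₁
      len₁ = proj₁ (proj₂ (proj₂ (proj₂ (proj₂ (proj₂ a₁)))))
      size₂ : length F₂ + b ≤ δ
      size₂ = begin
        length F₂ + b ≡⟨ cong (_+ b) (trans (length-++ ws₁) (trans (cong (_+ length F₁) len₁) (+-comm b _))) ⟩
        (length F₁ + b) + b ≡⟨ +-assoc (length F₁) b b ⟩
        length F₁ + (b + b) ≤⟨ size₁ ⟩
        δ ∎ where open ≤-Reasoning
      a₂ = greedyWalk b r F₂ h size₂ (∈-++⁺ʳ ws₁ (∈-++⁺ʳ ws₀ (here refl)))
      ws₂ = proj₁ (proj₂ a₂)
      Arm : List (Fin n) → Set
      Arm ws = ∃ λ z → Walk (Adj adj) r z (r ∷ ws) × Unique ws × ws ∥ F₀ × length ws ≡ b ×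
        (∀ {v} → v ∈ ws → Region v)
      arm : Fin 3 → ∃ Arm
      arm zero = ws₀ , proj₁ a₀ , proj₂ (proj₂ a₀)
      arm (suc zero) with a₁
      ... | z , ws , p , u , avoid , rest = ws , z , p , u , (λ v∈ q → avoid v∈ (∈-++⁺ʳ ws₀ q)) , rest
      arm (suc (suc zero)) with a₂
      ... | z , ws , p , u , avoid , rest =
        ws , z , p , u , (λ v∈ q → avoid v∈ (∈-++⁺ʳ ws₁ (∈-++⁺ʳ ws₀ q))) , rest
      avoid : ∀ κ → proj₁ (arm κ) ∥ F₀
      avoid κ = proj₁ (proj₂ (proj₂ (proj₂ (proj₂ (arm κ)))))
      avoid₁ : ws₁ ∥ F₁
      avoid₁ = proj₁ (proj₂ (proj₂ (proj₂ (proj₂ a₁))))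
      avoid₂ : ws₂ ∥ F₂
      avoid₂ = proj₁ (proj₂ (proj₂ (proj₂ (proj₂ a₂))))
      apart : ∀ κ ι {v} → v ∈ proj₁ (arm κ) → v ∈ proj₁ (arm ι) → κ ≡ ι
      apart zero zero p q = refl
      apart zero (suc zero) p q = ⊥-elim (avoid₁ q (∈-++⁺ˡ p))
      apart zero (suc (suc zero)) p q = ⊥-elim (avoid₂ q (∈-++⁺ʳ ws₁ (∈-++⁺ˡ p)))
      apart (suc zero) zero p q = ⊥-elim (avoid₁ p (∈-++⁺ˡ q))
      apart (suc zero) (suc zero) p q = refl
      apart (suc zero) (suc (suc zero)) p q = ⊥-elim (avoid₂ q (∈-++⁺ˡ p))
      apart (suc (suc zero)) zero p q = ⊥-elim (avoid₂ p (∈-++⁺ʳ ws₁ (∈-++⁺ˡ q)))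
      apart (suc (suc zero)) (suc zero) p q = ⊥-elim (avoid₂ p (∈-++⁺ˡ q))
      apart (suc (suc zero)) (suc (suc zero)) p q = refl
      S : Spider adj b
      S = record
        { centre = r ; arm = proj₁ ∘ arm ; end = λ κ → proj₁ (proj₂ (arm κ)) ; walk = λ κ → proj₁ (proj₂ (proj₂ (arm κ)))
        ; unique = λ κ → unique-∷ (λ r∈ → avoid κ r∈ (here refl)) (proj₁ (proj₂ (proj₂ (proj₂ (arm κ)))))
        ; len = λ κ → proj₁ (proj₂ (proj₂ (proj₂ (proj₂ (proj₂ (arm κ)))))) ; apart = λ {κ} {ι} → apart κ ι }
      which : ∀ {v} → v ∈ Spider.verts S → v ≡ r ⊎ (∃ λ κ → v ∈ proj₁ (arm κ))
      which (here eq) = inj₁ eq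
      which (there v∈) with ∈-++⁻ ws₀ v∈
      ... | inj₁ p = inj₂ (zero , p)
      ... | inj₂ q with ∈-++⁻ (proj₁ (arm (suc zero))) q
      ... | inj₁ p = inj₂ (suc zero , p)
      ... | inj₂ p = inj₂ (suc (suc zero) , p)
      avoidF : Spider.verts S ∥ F
      avoidF v∈ vF with which v∈
      ... | inj₁ refl = r∉ vF
      ... | inj₂ (κ , p) = avoid κ p (there vF)
      region : ∀ {v} → v ∈ Spider.verts S → Region v
      region v∈ with which v∈
      ... | inj₁ refl = H⊆ h
      ... | inj₂ (κ , p) = proj₂ (proj₂ (proj₂ (proj₂ (proj₂ (proj₂ (arm κ)))))) p

  -- Maximal packings of spiders and the ranks they induce

  record Packing (b : ℕ) (In : Fin n → Set) (ℓ : ℕ) : Set where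
    field
      spiders : Fin ℓ → Spider adj b
      within  : ∀ i {v} → v ∈ Spider.verts (spiders i) → In v
      apart   : ∀ {i j v} → v ∈ Spider.verts (spiders i) → v ∈ Spider.verts (spiders j) → i ≡ j

    Covered : Fin n → Set
    Covered v = ∃ λ i → v ∈ Spider.verts (spiders i)

  -- Every vertex outside the packing has K₂ out-neighbours of smaller rank, so following these
  -- leads to the packing within b steps.
  record Ranked (b K₂ : ℕ) (In : Fin n → Set) : Set where
    field
      ℓ       : ℕ
      packing : Packing b In ℓ
      rank    : Fin n → ℕ
      rank≤   : ∀ {v} → In v → rank v ≤ b
      rank0   : ∀ {v} → In v → rank v ≡ 0 → Packing.Covered packing v
      0rank   : ∀ {v} → Packing.Covered packing v → rank v ≡ 0
      lower   : ∀ {v j} → In v → rank v ≡ suc j →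
        ∃ λ N → Unique N × K₂ ≤ length N × (∀ {w} → w ∈ N → Adj adj v w × In w × rank w ≤ j)

  -- A packing that cannot be extended provides the ranks. Layer zero is the packing, and each layer
  -- adds the vertices with `K₂` out-neighbours in the previous one. A vertex missed by layer `b`
  -- has many out-neighbours missed by layer `b - 1`, and so on, so a spider with arms of length `b`
  -- grows from it without touching the packing. The rank of a vertex is its first layer.
  ranked : ∀ b K₁ K₂ {In : Fin n → Set} (In? : ∀ v → Dec (In v)) →
    (∀ {v} → In v → K₁ ≤ length (filter In? (outs adj v))) → K₂ + suc (b + (b + b)) ≤ K₁ → Ranked b K₂ In
  ranked b K₁ K₂ {In} In? rich K₂≤ = extend n (record { spiders = λ () ; within = λ () ; apart = λ { {()} } }) (m≤m+n n 0)
    where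
    open import Data.List.Membership.DecPropositional (Fin._≟_ {n}) using (_∈?_)
    δ = suc (b + (b + b))

    module Layers {ℓ} (P : Packing b In ℓ) where
      open Packing P
      Layer : ℕ → Fin n → Set
      Layer? : ∀ j v → Dec (Layer j v)
      Layer zero v = Covered v
      Layer (suc j) v = Layer j v ⊎ (In v × K₂ ≤ length (filter (Layer? j) (outs adj v)))
      Layer? zero v = Fin.any? (λ i → v ∈? Spider.verts (spiders i))
      Layer? (suc j) v = Layer? j v ⊎-dec (In? v ×-dec (_ ≤? _))

      inside : ∀ j {v} → Layer j v → In v
      inside zero (i , v∈) = within i v∈
      inside (suc j) (inj₁ p) = inside j p
      inside (suc j) (inj₂ (p , _)) = p

      mono : ∀ {i j v} → i ≤ j → Layer i v → Layer j v
      mono {zero} {zero} _ p = p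
      mono {zero} {suc j} _ p = inj₁ (mono {zero} {j} z≤n p)
      mono {suc i} {suc j} (s≤s le) p with ≤-<-connex j i
      ... | inj₁ j≤i = subst (λ m → Layer (suc m) _) (≤-antisym le j≤i) p
      ... | inj₂ i<j = inj₁ (mono {suc i} {j} i<j p)

      rk : ℕ → Fin n → ℕ
      rk zero v = 0
      rk (suc j) v with Layer? j v
      ... | yes _ = rk j v
      ... | no _ = suc j

      rk-Layer : ∀ j {v} → Layer j v → Layer (rk j v) v
      rk-Layer zero p = p
      rk-Layer (suc j) {v} p with Layer? j v
      ... | yes q = rk-Layer j q
      ... | no _ = p

      rk≤ : ∀ j v → rk j v ≤ j
      rk≤ zero v = z≤n
      rk≤ (suc j) v with Layer? j v
      ... | yes _ = m≤n⇒m≤1+n (rk≤ j v)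
      ... | no _ = ≤-refl

      rk-least : ∀ j {i v} → Layer i v → rk j v ≤ i
      rk-least zero _ = z≤n
      rk-least (suc j) {i} {v} p with Layer? j v
      ... | yes _ = rk-least j p
      ... | no ¬q with ≤-<-connex i j
      ... | inj₁ i≤j = ⊥-elim (¬q (mono i≤j p))
      ... | inj₂ j<i = j<i

      ranking : (∀ v → In v → Layer b v) → Ranked b K₂ In
      ranking full = record
        { ℓ = ℓ ; packing = P ; rank = rk b ; rank≤ = λ {v} _ → rk≤ b v
        ; rank0 = λ {v} v∈ eq → subst (λ j → Layer j v) eq (rk-Layer b (full v v∈))
        ; 0rank = λ {v} c → n≤0⇒n≡0 (rk-least b {0} c)
        ; lower = lower }
        where
        lower : ∀ {v j} → In v → rk b v ≡ suc j →
          ∃ λ N → Unique N × K₂ ≤ length N × (∀ {w} → w ∈ N → Adj adj v w × In w × rk b w ≤ j)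
        lower {v} {j} v∈ eq with subst (λ j → Layer j v) eq (rk-Layer b (full v v∈))
        ... | inj₁ p = ⊥-elim (1+n≰n (subst (_≤ j) eq (rk-least b p)))
        ... | inj₂ (_ , le) = filter (Layer? j) (outs adj v) , Uniq.filter⁺ _ (outs-unique adj v) , le , good
          where
          good : ∀ {w} → w ∈ filter (Layer? j) (outs adj v) → Adj adj v w × In w × rk b w ≤ j
          good w∈ with ∈-filter⁻ (Layer? j) {xs = outs adj v} w∈
          ... | w∈′ , Lw = ∈-outs⁻ adj w∈′ , inside j Lw , rk-least b Lw

      H : ℕ → Fin n → Set
      H j v = In v × ¬ Layer j v

      -- Outside layer `suc j`, fewer than `K₂` out-neighbours lie in layer `j`; removing them from
      -- the at least `K₁` out-neighbours in `In` leaves `δ`, the size of a whole spider.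
      descend : ∀ j v → H (suc j) v →
        ∃ λ N → Unique N × δ ≤ length N × (∀ {w} → w ∈ N → Adj adj v w × H j w)
      descend j v (v∈ , ¬L) =
          filter (¬? ∘ Layer? j) I , Uniq.filter⁺ _ (Uniq.filter⁺ _ (outs-unique adj v))
        , +-cancelˡ-≤ K₂ _ _ (≤-trans K₂≤ (≤-trans (rich v∈) (≤-trans (≤-reflexive (sym (length-filter-partition (Layer? j) I))) (+-monoˡ-≤ _ few))))
        , λ w∈ → let (w∈I , ¬Lw) = ∈-filter⁻ (¬? ∘ Layer? j) {xs = I} w∈
                     (w∈o , wIn) = ∈-filter⁻ In? {xs = outs adj v} w∈I
                 in ∈-outs⁻ adj w∈o , wIn , ¬Lw
        where
        I = filter In? (outs adj v)
        few : length (filter (Layer? j) I) ≤ K₂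
        few = ≤-trans (unique-⊑⇒length≤ (Uniq.filter⁺ _ (Uniq.filter⁺ _ (outs-unique adj v)))
                (λ w∈ → let (w∈I , Lw) = ∈-filter⁻ (Layer? j) {xs = I} w∈
                        in ∈-filter⁺ (Layer? j) (proj₁ (∈-filter⁻ In? {xs = outs adj v} w∈I)) Lw))
              (<⇒≤ (≰⇒> (λ le → ¬L (inj₂ (v∈ , le)))))

    extend : ∀ fuel {ℓ} (P : Packing b In ℓ) → n ≤ fuel + ℓ → Ranked b K₂ In
    extend fuel {ℓ} P le with Fin.any? (λ v → In? v ×-dec ¬? (Layers.Layer? P b v))
    ... | no ¬r = Layers.ranking P λ v v∈ → full v v∈ (Layers.Layer? P b v)
      where
      full : ∀ v → In v → Dec (Layers.Layer P b v) → Layers.Layer P b v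
      full v v∈ (yes p) = p
      full v v∈ (no ¬p) = ⊥-elim (¬r (v , v∈ , ¬p))
    ... | yes (r , r∈) = continue fuel le
      where
      open Layers P using (H; descend; mono)
      module G = Greedy H δ descend (λ v → In v × ¬ Packing.Covered P v) (λ (p , q) → p , q ∘ mono z≤n)
      new : ∃ λ (S : Spider adj b) → Spider.centre S ≡ r × (Spider.verts S ∥ []) ×
        (∀ {v} → v ∈ Spider.verts S → In v × ¬ Packing.Covered P v)
      new = G.spider b r [] r∈ (λ ()) ≤-refl
      S = proj₁ new
      reg = proj₂ (proj₂ (proj₂ new))
      spiders′ : Fin (suc ℓ) → Spider adj b
      spiders′ zero = S
      spiders′ (suc i) = Packing.spiders P i
      P′ : Packing b In (suc ℓ)
      P′ = record { spiders = spiders′ ; within = within′ ; apart = λ {i} {j} → apart′ i j }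
        where
        within′ : ∀ i {v} → v ∈ Spider.verts (spiders′ i) → In v
        within′ zero v∈ = proj₁ (reg v∈)
        within′ (suc i) v∈ = Packing.within P i v∈
        apart′ : ∀ i j {v} → v ∈ Spider.verts (spiders′ i) → v ∈ Spider.verts (spiders′ j) → i ≡ j
        apart′ zero zero p q = refl
        apart′ zero (suc j) p q = ⊥-elim (proj₂ (reg p) (j , q))
        apart′ (suc i) zero p q = ⊥-elim (proj₂ (reg q) (i , p))
        apart′ (suc i) (suc j) p q = cong suc (Packing.apart P p q)
      continue : ∀ fuel → n ≤ fuel + ℓ → Ranked b K₂ In
      -- Out of fuel, the `suc ℓ` spiders would have more distinct centres than there are vertices.
      continue zero le = ⊥-elim (<⇒≱ (s≤s le) (Fin.injective⇒≤ {f = λ i → Spider.centre (spiders′ i)}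
        (λ {i} {j} eq → Packing.apart P′ {i} {j} (here refl) (subst (_∈ Spider.verts (spiders′ j)) (sym eq) (here refl)))))
      continue (suc fuel) le = extend fuel P′ (subst (n ≤_) (sym (+-suc fuel ℓ)) le)

-- Sums over lists

∑ : {A : Set} → List A → (A → ℕ) → ℕ
∑ xs f = sum (map f xs)

∑-+ : {A : Set} (xs : List A) (f g : A → ℕ) → ∑ xs (λ x → f x + g x) ≡ ∑ xs f + ∑ xs g
∑-+ [] f g = refl
∑-+ (x ∷ xs) f g = trans (cong (f x + g x +_) (∑-+ xs f g)) (+-interchange (f x) (g x) (∑ xs f) (∑ xs g))
  where
  +-interchange : ∀ a b c d → (a + b) + (c + d) ≡ (a + c) + (b + d)
  +-interchange = solve-∀

∑-mono : {A : Set} (xs : List A) {f g : A → ℕ} → (∀ {x} → x ∈ xs → f x ≤ g x) → ∑ xs f ≤ ∑ xs g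
∑-mono [] le = z≤n
∑-mono (x ∷ xs) le = +-mono-≤ (le (here refl)) (∑-mono xs (le ∘ there))

∑-*ˡ : {A : Set} (xs : List A) (c : ℕ) (f : A → ℕ) → ∑ xs (λ x → c * f x) ≡ c * ∑ xs f
∑-*ˡ [] c f = sym (*-zeroʳ c)
∑-*ˡ (x ∷ xs) c f = trans (cong (c * f x +_) (∑-*ˡ xs c f)) (sym (*-distribˡ-+ c (f x) (∑ xs f)))

∑-const : {A : Set} (xs : List A) (c : ℕ) → ∑ xs (λ _ → c) ≡ length xs * c
∑-const [] c = refl
∑-const (x ∷ xs) c = cong (c +_) (∑-const xs c)

∑-lower : {A : Set} {P : A → Set} (P? : Decidable P) (xs : List A) (f : A → ℕ) (c e : ℕ) →
  (∀ {x} → x ∈ xs → c ≤ f x) → (∀ {x} → x ∈ xs → P x → c + e ≤ f x) →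
  length xs * c + length (filter P? xs) * e ≤ ∑ xs f
∑-lower P? [] f c e _ _ = z≤n
∑-lower P? (x ∷ xs) f c e low high with P? x | ∑-lower P? xs f c e (low ∘ there) (high ∘ there)
... | yes p | ih = begin
  (c + length xs * c) + (e + length (filter P? xs) * e) ≡⟨ regroup c (length xs * c) e _ ⟩
  (c + e) + (length xs * c + length (filter P? xs) * e) ≤⟨ +-mono-≤ (high (here refl) p) ih ⟩
  f x + ∑ xs f ∎
  where
  open ≤-Reasoning
  regroup : ∀ a b c d → (a + b) + (c + d) ≡ (a + c) + (b + d)
  regroup = solve-∀
... | no _ | ih = ≤-trans (≤-reflexive (+-assoc c _ _)) (+-mono-≤ (low (here refl)) ih)

average : {A : Set} (x : A) (xs : List A) (f : A → ℕ) (c : ℕ) → length (x ∷ xs) * c ≤ ∑ (x ∷ xs) f →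
  ∃ λ y → y ∈ x ∷ xs × c ≤ f y
average x [] f c le = x , here refl , subst₂ _≤_ (+-identityʳ c) (+-identityʳ (f x)) le
average x (y ∷ xs) f c le with c ≤? f x
... | yes p = x , here refl , p
... | no p = map₂ (map₁ there) (average y xs f c (+-cancelˡ-≤ (f x) _ _ (≤-trans (+-monoˡ-≤ _ (≰⇒≥ p)) le)))

-- One `x` has to serve all of `ps` at once, so the averaging is applied to the total over `ps`,
-- after exchanging the two sums.
average₂ : {A P : Set} (xs : List A) (ps : List P) (F : A → P → ℕ) (G : P → ℕ) → 0 < length xs →
  (∀ {p} → p ∈ ps → length xs * G p ≤ ∑ xs (λ x → F x p)) → ∃ λ x → x ∈ xs × ∑ ps G ≤ ∑ ps (F x)
average₂ xs@(x ∷ xs′) ps F G pos le = average x xs′ (λ x → ∑ ps (F x)) (∑ ps G) (total ps le)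
  where
  total : ∀ ps → (∀ {p} → p ∈ ps → length xs * G p ≤ ∑ xs (λ x → F x p)) →
    length xs * ∑ ps G ≤ ∑ xs (λ x → ∑ ps (F x))
  total [] _ = ≤-trans (≤-reflexive (*-zeroʳ (length xs))) z≤n
  total (p ∷ ps) le = begin
    length xs * (G p + ∑ ps G) ≡⟨ *-distribˡ-+ (length xs) (G p) _ ⟩
    length xs * G p + length xs * ∑ ps G ≤⟨ +-mono-≤ (le (here refl)) (total ps (le ∘ there)) ⟩
    ∑ xs (λ x → F x p) + ∑ xs (λ x → ∑ ps (F x)) ≡⟨ ∑-+ xs (λ x → F x p) (λ x → ∑ ps (F x)) ⟨
    ∑ xs (λ x → F x p + ∑ ps (F x)) ∎
    where open ≤-Reasoning

module _ {A : Set} (_≟_ : DecidableEquality A) where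

  delete : A → List A → List A
  delete r = filter (λ x → ¬? (x ≟ r))

  ∈-delete⁻ : ∀ {r x} xs → x ∈ delete r xs → x ∈ xs × x ≢ r
  ∈-delete⁻ {r} xs = ∈-filter⁻ (λ x → ¬? (x ≟ r)) {xs = xs}

  ∈-delete⁺ : ∀ {r x xs} → x ∈ xs → x ≢ r → x ∈ delete r xs
  ∈-delete⁺ {r} = ∈-filter⁺ (λ x → ¬? (x ≟ r))

  delete-unique : ∀ {r xs} → Unique xs → Unique (delete r xs)
  delete-unique = Uniq.filter⁺ _

  length-delete : ∀ {r xs} → r ∈ xs → length (delete r xs) < length xs
  length-delete {r} {xs} r∈ = filter-notAll (λ x → ¬? (x ≟ r)) xs (lose r∈ (λ ne → ne refl))

  ∑-delete : ∀ (f : A → ℕ) {r xs} → Unique xs → r ∈ xs → ∑ xs f ≡ f r + ∑ (delete r xs) f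
  ∑-delete f {r} {x ∷ xs} u r∈ with x ≟ r
  ∑-delete f {r} {.r ∷ xs} u r∈ | yes refl = cong (λ ys → f r + ∑ ys f)
    (sym (filter-all (λ x → ¬? (x ≟ r)) {xs} (All.tabulate (λ x∈ eq → head-∉ u (subst (_∈ xs) eq x∈)))))
  ∑-delete f {r} {x ∷ xs} u (here refl) | no x≢r = ⊥-elim (x≢r refl)
  ∑-delete f {r} {x ∷ xs} (_ ∷ u) (there r∈) | no x≢r =
    trans (cong (f x +_) (∑-delete f u r∈)) (swap+ (f x) (f r) _)
    where
    swap+ : ∀ a b c → a + (b + c) ≡ b + (a + c)
    swap+ = solve-∀

-- Eliminating the vertices outside a packing

module Elimination {n : ℕ} (adj : Fin n → Fin n → Bool) {b K₂ : ℕ} {In : Fin n → Set}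
  (In? : ∀ v → Dec (In v)) (R : Ranked adj b K₂ In) (d : ℕ) (0<K₂ : 0 < K₂) (db≤K₂ : d * b ≤ K₂) where

  open Ranked R
  open Packing packing using (Covered)
  open import Data.List.Membership.DecPropositional (Fin._≟_ {n}) using (_∈?_)

  V : Set
  V = Fin n

  -- The decrease of W along the ranks pays for the merges that each of the at most b moves may cause.
  W : V → ℕ
  W v = K₂ ∸ d * rank v

  weight : List V → ℕ
  weight xs = ∑ xs W

  W-lower : ∀ {v w j} → In v → rank v ≡ suc j → rank w ≤ j → W v + d ≤ W w
  W-lower {v} {w} {j} v∈ eq le = begin
    K₂ ∸ d * rank v + d ≡⟨ cong (λ r → K₂ ∸ d * r + d) eq ⟩
    K₂ ∸ d * suc j + d ≡⟨ cong (λ x → K₂ ∸ x + d) (trans (*-suc d j) (+-comm d (d * j))) ⟩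
    K₂ ∸ (d * j + d) + d ≡⟨ cong (_+ d) (sym (∸-+-assoc K₂ (d * j) d)) ⟩
    K₂ ∸ d * j ∸ d + d ≡⟨ m∸n+n≡m (m+n≤o⇒m≤o∸n d (≤-trans (≤-reflexive (sym (*-suc d j))) dj≤)) ⟩
    K₂ ∸ d * j ≤⟨ ∸-monoʳ-≤ K₂ (*-monoʳ-≤ d le) ⟩
    K₂ ∸ d * rank w ∎
    where
    open ≤-Reasoning
    -- Ranks are at most `b`, so the truncated subtraction in `W` never actually truncates.
    dj≤ : d * suc j ≤ K₂
    dj≤ = ≤-trans (*-monoʳ-≤ d (subst (_≤ b) eq (rank≤ v∈))) db≤K₂

  -- Redirects the walk now standing at `r` to `v`. If `v` is already occupied, two walks merge and
  -- the list loses an element.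
  move : V → V → List V → List V
  move r v xs with r ∈? xs | v ∈? xs
  ... | no _ | _ = xs
  ... | yes _ | yes _ = delete Fin._≟_ r xs
  ... | yes _ | no _ = v ∷ delete Fin._≟_ r xs

  ∈-move⁻ : ∀ r v xs {x} → x ∈ move r v xs → (x ≡ v × r ∈ xs) ⊎ (x ∈ xs × x ≢ r)
  ∈-move⁻ r v xs x∈ with r ∈? xs | v ∈? xs
  ... | no r∉ | _ = inj₂ (x∈ , λ eq → r∉ (subst (_∈ xs) eq x∈))
  ... | yes _ | yes _ = inj₂ (∈-delete⁻ Fin._≟_ xs x∈)
  ∈-move⁻ r v xs (here eq) | yes r∈ | no _ = inj₁ (eq , r∈)
  ∈-move⁻ r v xs (there x∈) | yes _ | no _ = inj₂ (∈-delete⁻ Fin._≟_ xs x∈)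

  move-unique : ∀ r v {xs} → Unique xs → Unique (move r v xs)
  move-unique r v {xs} u with r ∈? xs | v ∈? xs
  ... | no _ | _ = u
  ... | yes _ | yes _ = Uniq.filter⁺ _ u
  ... | yes _ | no v∉ = unique-∷ (v∉ ∘ proj₁ ∘ ∈-delete⁻ Fin._≟_ xs) (Uniq.filter⁺ _ u)

  move-length : ∀ r v xs → length (move r v xs) ≤ length xs
  move-length r v xs with r ∈? xs | v ∈? xs
  ... | no _ | _ = ≤-refl
  ... | yes r∈ | yes _ = <⇒≤ (length-delete Fin._≟_ r∈)
  ... | yes r∈ | no _ = length-delete Fin._≟_ r∈

  move-∉ : ∀ {r v xs} → r ∉ xs → move r v xs ≡ xs
  move-∉ {r} {v} {xs} r∉ with r ∈? xs
  ... | no _ = refl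
  ... | yes r∈ = ⊥-elim (r∉ r∈)

  move-low : ∀ {r v xs} → r ∈ xs → weight (delete Fin._≟_ r xs) ≤ weight (move r v xs)
  move-low {r} {v} {xs} r∈ with r ∈? xs | v ∈? xs
  ... | no r∉ | _ = ⊥-elim (r∉ r∈)
  ... | yes _ | yes _ = ≤-refl
  ... | yes _ | no _ = m≤n+m _ (W v)

  move-high : ∀ {r v xs} → r ∈ xs → v ∉ xs → weight (delete Fin._≟_ r xs) + W v ≤ weight (move r v xs)
  move-high {r} {v} {xs} r∈ v∉ with r ∈? xs | v ∈? xs
  ... | no r∉ | _ = ⊥-elim (r∉ r∈)
  ... | yes _ | yes v∈ = ⊥-elim (v∉ v∈)
  ... | yes _ | no _ = ≤-reflexive (+-comm _ (W v))

  -- Let `m` members of `N` lie outside `xs`. Each of these choices gains at least `d`; each of the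
  -- others, at most `d` in number, merges and loses `W r`. The gain `m * d` covers the loss
  -- `d * W r`, because `W r + d ≤ K₂ ≤ length N ≤ d + m`.
  move-average : ∀ {r N xs} → Unique N → K₂ ≤ length N → W r + d ≤ K₂ → (∀ {v} → v ∈ N → W r + d ≤ W v) →
    Unique xs → length xs ≤ d → length N * weight xs ≤ ∑ N (λ v → weight (move r v xs))
  move-average {r} {N} {xs} uN K₂≤ Wr+d≤ heavier uxs len = [ present , absent ]′ (Dec.toSum (r ∈? xs))
    where
    absent : r ∉ xs → length N * weight xs ≤ ∑ N (λ v → weight (move r v xs))
    absent r∉ = ≤-trans (≤-reflexive (sym (∑-const N (weight xs))))
                  (∑-mono N (λ {v} _ → ≤-reflexive (cong weight (sym (move-∉ {r} {v} r∉)))))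
    present : r ∈ xs → length N * weight xs ≤ ∑ N (λ v → weight (move r v xs))
    present r∈ = begin
      length N * weight xs ≡⟨ cong (length N *_) (∑-delete Fin._≟_ W uxs r∈) ⟩
      length N * (W r + c) ≡⟨ *-distribˡ-+ (length N) (W r) c ⟩
      length N * W r + length N * c ≡⟨ +-comm (length N * W r) _ ⟩
      length N * c + length N * W r ≤⟨ +-monoʳ-≤ (length N * c) count ⟩
      length N * c + m * (W r + d) ≤⟨ ∑-lower (λ x → ¬? (x ∈? xs)) N _ c (W r + d) (λ _ → move-low r∈)
                                        (λ v∈ v∉ → ≤-trans (+-monoʳ-≤ c (heavier v∈)) (move-high r∈ v∉)) ⟩
      ∑ N (λ v → weight (move r v xs)) ∎
      where
      open ≤-Reasoning
      c = weight (delete Fin._≟_ r xs)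
      m = length (without Fin._≟_ xs N)
      N≤ : length N ≤ d + m
      N≤ = ≤-trans (length-without Fin._≟_ xs uN) (+-monoˡ-≤ m len)
      Wr≤m : W r ≤ m
      Wr≤m = +-cancelʳ-≤ d _ _ (≤-trans Wr+d≤ (≤-trans K₂≤ (≤-trans N≤ (≤-reflexive (+-comm d m)))))
      count : length N * W r ≤ m * (W r + d)
      count = begin
        length N * W r ≤⟨ *-monoˡ-≤ (W r) N≤ ⟩
        (d + m) * W r ≡⟨ *-distribʳ-+ (W r) d m ⟩
        d * W r + m * W r ≤⟨ +-monoˡ-≤ (m * W r) (*-monoʳ-≤ d Wr≤m) ⟩
        d * m + m * W r ≡⟨ regroup d m (W r) ⟩
        m * (W r + d) ∎
        where
        regroup : ∀ d m w → d * m + m * w ≡ m * (w + d)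
        regroup = solve-∀

  -- Rank first, index second, packed into one number. Elimination runs down the keys; a key below
  -- `n` means rank zero, where the packing is reached.
  key : V → ℕ
  key v = toℕ v + rank v * n

  key-rank : ∀ {v w} → rank w < rank v → key w < key v
  key-rank {v} {w} lt = begin-strict
    toℕ w + rank w * n <⟨ +-monoˡ-< (rank w * n) (Fin.toℕ<n w) ⟩
    suc (rank w) * n ≤⟨ *-monoˡ-≤ n lt ⟩
    rank v * n ≤⟨ m≤n+m _ (toℕ v) ⟩
    key v ∎
    where open ≤-Reasoning

  key-injective : ∀ {v w} → key v ≡ key w → v ≡ w
  key-injective {v} {w} eq with <-cmp (rank v) (rank w)
  ... | tri< lt _ _ = ⊥-elim (<⇒≢ (key-rank lt) eq)
  ... | tri> _ _ gt = ⊥-elim (<⇒≢ (key-rank gt) (sym eq))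
  ... | tri≈ _ same _ = Fin.toℕ-injective (+-cancelʳ-≡ (rank v * n) _ _ (trans eq (cong (λ r → toℕ w + r * n) (sym same))))

  key<n⇒rank0 : ∀ {v} → key v < n → rank v ≡ 0
  key<n⇒rank0 {v} lt with rank v
  ... | zero = refl
  ... | suc r = ⊥-elim (<⇒≱ lt (≤-trans (m≤m+n n _) (m≤n+m _ (toℕ v))))

  -- e sends a vertex to the root of its tree in a forest with roots in the packing.
  Rooted : (V → V) → ℕ → Set
  Rooted e m = ∀ {v} → In v → key v < m → Covered (e v) × ∃ λ xs →
    Walk (Adj adj) v (e v) xs × length xs ≤ suc (rank v) × (∀ {x} → x ∈ xs → In x × e x ≡ e v × key x < m)

  module _ {P : Set} (ps : List P) where

    Thin : (P → List V) → Set
    Thin Γ = ∀ p → Unique (Γ p) × length (Γ p) ≤ d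

    -- The vertex `r` of highest key is given one out-neighbour `v` of smaller rank, the same for
    -- every `p`, so that the choices form a forest; `average₂` supplies a `v` for which the total
    -- weight does not drop. In the end only vertices of the packing remain, each of weight at most
    -- `K₂`, and the weight turns into a lower bound on the number of distinct roots.
    eliminate : ∀ i Γ → Thin Γ → (∀ p {x} → x ∈ Γ p → In x × key x < n + i) →
      ∃ λ e → Rooted e (n + i) × ∃ λ Γ′ → Thin Γ′ ×
        (∀ p {t} → t ∈ Γ′ p → Covered t × ∃ λ x → x ∈ Γ p × e x ≡ t) ×
        ∑ ps (weight ∘ Γ) ≤ K₂ * ∑ ps (length ∘ Γ′)
    eliminate zero Γ thin sup = id , rooted , Γ , thin , (λ p t∈ → root (sup p t∈) , _ , t∈ , refl) , total
      where
      root : ∀ {x} → In x × key x < n + 0 → Covered x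
      root {x} (x∈ , lt) = rank0 x∈ (key<n⇒rank0 (subst (key x <_) (+-identityʳ n) lt))
      rooted : Rooted id (n + 0)
      rooted {v} v∈ lt = root (v∈ , lt) , v ∷ [] , [] , s≤s z≤n , λ { (here refl) → v∈ , refl , lt }
      total : ∑ ps (weight ∘ Γ) ≤ K₂ * ∑ ps (length ∘ Γ)
      total = begin
        ∑ ps (weight ∘ Γ) ≤⟨ ∑-mono ps (λ {p} _ → ≤-trans (∑-mono (Γ p) (λ {x} _ → m∸n≤m K₂ (d * rank x)))
                                       (≤-reflexive (trans (∑-const (Γ p) K₂) (*-comm (length (Γ p)) K₂)))) ⟩
        ∑ ps (λ p → K₂ * length (Γ p)) ≡⟨ ∑-*ˡ ps K₂ (length ∘ Γ) ⟩
        K₂ * ∑ ps (length ∘ Γ) ∎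
        where open ≤-Reasoning
    eliminate (suc i) Γ thin sup with Fin.any? (λ v → In? v ×-dec (key v ℕ.≟ n + i))
    ... | no none = let (e , rooted , rest) = eliminate i Γ thin (λ p x∈ → let (xIn , lt) = sup p x∈ in xIn , lower< xIn lt)
                    in e , (λ v∈ lt → let (c , xs , w , len , same) = rooted v∈ (lower< v∈ lt)
                                      in c , xs , w , len , λ x∈ → let (xIn , eq , lt′) = same x∈ in xIn , eq , raise lt′) , rest
      where
      lower< : ∀ {v} → In v → key v < n + suc i → key v < n + i
      lower< {v} v∈ lt = ≤∧≢⇒< (≤-pred (subst (key v <_) (+-suc n i) lt)) (λ eq → none (v , v∈ , eq))
      raise : ∀ {k} → k < n + i → k < n + suc i
      raise {k} lt = subst (k <_) (sym (+-suc n i)) (m≤n⇒m≤1+n lt)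
    ... | yes (r , rIn , key-r) with rank r in rank-r
    -- A vertex of rank zero has key below `n` and is never eliminated.
    ... | zero = ⊥-elim (<⇒≱ (Fin.toℕ<n r) (≤-trans (m≤m+n n i) (≤-reflexive (trans (sym key-r) (+-identityʳ _)))))
    ... | suc j with lower rIn rank-r
    ... | N , uN , K₂≤ , good
      with average₂ N ps (λ v p → weight (move r v (Γ p))) (weight ∘ Γ) (<-≤-trans 0<K₂ K₂≤)
             (λ {p} _ → move-average {r} uN K₂≤ Wr+d≤ (λ v∈ → W-lower rIn rank-r (proj₂ (proj₂ (good v∈)))) (proj₁ (thin p)) (proj₂ (thin p)))
      where
      Wr+d≤ : W r + d ≤ K₂
      Wr+d≤ with pick Fin._≟_ {ys = []} uN (<-≤-trans 0<K₂ K₂≤)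
      ... | w , w∈ , _ = ≤-trans (W-lower rIn rank-r (proj₂ (proj₂ (good w∈)))) (m∸n≤m K₂ (d * rank w))
    ... | v , v∈ , gain = finish (eliminate i (λ p → move r v (Γ p)) thin′ sup′)
      where
      key-r′ : key r ≡ n + i
      key-r′ = trans (cong (λ k → toℕ r + k * n) rank-r) key-r
      vAdj = proj₁ (good v∈)
      vIn = proj₁ (proj₂ (good v∈))
      rank-v : rank v ≤ j
      rank-v = proj₂ (proj₂ (good v∈))
      key-v : key v < n + i
      key-v = subst (key v <_) key-r′ (key-rank (subst (rank v <_) (sym rank-r) (s≤s rank-v)))
      lower< : ∀ {x} → x ≢ r → key x < n + suc i → key x < n + i
      lower< {x} ne lt = ≤∧≢⇒< (≤-pred (subst (key x <_) (+-suc n i) lt)) (λ eq → ne (key-injective (trans eq (sym key-r′))))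
      raise : ∀ {k} → k < n + i → k < n + suc i
      raise {k} lt = subst (k <_) (sym (+-suc n i)) (m≤n⇒m≤1+n lt)
      thin′ : Thin (λ p → move r v (Γ p))
      thin′ p = move-unique r v (proj₁ (thin p)) , ≤-trans (move-length r v (Γ p)) (proj₂ (thin p))
      sup′ : ∀ p {x} → x ∈ move r v (Γ p) → In x × key x < n + i
      sup′ p x∈ with ∈-move⁻ r v (Γ p) x∈
      ... | inj₁ (refl , _) = vIn , key-v
      ... | inj₂ (x∈′ , ne) = let (xIn , lt) = sup p x∈′ in xIn , lower< ne lt
      finish : (∃ λ e → Rooted e (n + i) × ∃ λ Γ′ → Thin Γ′ ×
                 (∀ p {t} → t ∈ Γ′ p → Covered t × ∃ λ x → x ∈ move r v (Γ p) × e x ≡ t) ×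
                 ∑ ps (λ p → weight (move r v (Γ p))) ≤ K₂ * ∑ ps (length ∘ Γ′)) →
               ∃ λ e → Rooted e (n + suc i) × ∃ λ Γ′ → Thin Γ′ ×
                 (∀ p {t} → t ∈ Γ′ p → Covered t × ∃ λ x → x ∈ Γ p × e x ≡ t) ×
                 ∑ ps (weight ∘ Γ) ≤ K₂ * ∑ ps (length ∘ Γ′)
      finish (e , rooted , Γ′ , thinΓ′ , from , total) = e′ , rooted′ , Γ′ , thinΓ′ , from′ , ≤-trans gain total
        where
        e′ : V → V
        e′ x with x Fin.≟ r
        ... | yes _ = e v
        ... | no _ = e x
        e′-r : e′ r ≡ e v
        e′-r with r Fin.≟ r
        ... | yes _ = refl
        ... | no ne = ⊥-elim (ne refl)
        e′-≢ : ∀ {x} → x ≢ r → e′ x ≡ e x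
        e′-≢ {x} ne with x Fin.≟ r
        ... | yes eq = ⊥-elim (ne eq)
        ... | no _ = refl
        e′-< : ∀ {x} → key x < n + i → e′ x ≡ e x
        e′-< lt = e′-≢ (λ { refl → <⇒≢ lt key-r′ })
        rooted′ : Rooted e′ (n + suc i)
        rooted′ {x} xIn lt with x Fin.≟ r
        ... | no ne = let (c , xs , w , len , same) = rooted xIn (lower< ne lt)
                      in c , xs , w , len , λ y∈ → let (yIn , eq , lt′) = same y∈ in yIn , trans (e′-< lt′) eq , raise lt′
        ... | yes refl = let (c , xs , w , len , same) = rooted vIn key-v
                      in c , r ∷ xs , vAdj ∷ w
                       , s≤s (≤-trans len (subst (suc (rank v) ≤_) (sym rank-r) (s≤s rank-v)))
                       , λ { (here refl) → rIn , e′-r , lt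
                           ; (there y∈) → let (yIn , eq , lt′) = same y∈ in yIn , trans (e′-< lt′) eq , raise lt′ }
        from′ : ∀ p {t} → t ∈ Γ′ p → Covered t × ∃ λ x → x ∈ Γ p × e′ x ≡ t
        from′ p t∈ with from p t∈
        ... | c , x , x∈ , eq with ∈-move⁻ r v (Γ p) x∈
        ... | inj₁ (refl , r∈) = c , r , r∈ , trans e′-r eq
        ... | inj₂ (x∈′ , ne) = c , x , x∈′ , trans (e′-≢ ne) eq

-- Pruning to large degrees and chains of spiders

bools : List Bool
bools = false ∷ true ∷ []

∈-bools : ∀ κ → κ ∈ bools
∈-bools false = here refl
∈-bools true = there (here refl)

length-×bools : {A : Set} (xs : List A) → length (cartesianProduct xs bools) ≡ length xs * 2
length-×bools [] = refl
length-×bools (x ∷ xs) = cong (2 +_) (length-×bools xs)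

×bools-unique : {A : Set} {xs : List A} → Unique xs → Unique (cartesianProduct xs bools)
×bools-unique u = Uniq.cartesianProduct⁺ u (unique-∷ (λ { (here ()) ; (there ()) }) (unique-∷ (λ ()) []))

length-concatMap≤ : {A B : Set} (f : A → List B) (k : ℕ) → (∀ x → length (f x) ≤ k) →
  ∀ xs → length (concatMap f xs) ≤ length xs * k
length-concatMap≤ f k le [] = z≤n
length-concatMap≤ f k le (x ∷ xs) = ≤-trans (≤-reflexive (length-++ (f x))) (+-mono-≤ (le x) (length-concatMap≤ f k le xs))

length-allFin : ∀ n → length (allFin n) ≡ n
length-allFin n = length-tabulate id

module Pruning {n ℓ : ℕ} (Γ : Fin ℓ × Bool → List (Fin n)) (c β : ℕ)
  (Γ-unique : ∀ p → Unique (Γ p)) (Γ-short : ∀ p → length (Γ p) ≤ c + c) where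

  open import Data.List.Membership.DecPropositional (Fin._≟_ {n}) using (_∈?_)

  V I Port : Set
  V = Fin n
  I = Fin ℓ
  Port = I × Bool

  ports : List I → List Port
  ports S = cartesianProduct S bools

  nbrs : List V → Port → List V
  nbrs U p = filter (_∈? U) (Γ p)

  hosts : List I → V → List Port
  hosts S t = filter (λ p → t ∈? Γ p) (ports S)

  edges : List I → List V → ℕ
  edges S U = ∑ (ports S) (length ∘ nbrs U)

  -- Both ports of a spider must stay rich: a chain may enter by either one and then has to leave by
  -- the other.
  record Pruned : Set where
    field
      S        : List I
      U        : List V
      S-unique : Unique S
      root     : I
      root∈    : root ∈ S
      port-deg : ∀ {i} κ → i ∈ S → c < length (nbrs U (i , κ))
      sink-deg : ∀ {t} → t ∈ U → β < length (hosts S t)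

  nbrs-short : ∀ U p → length (nbrs U p) ≤ c + c
  nbrs-short U p = ≤-trans (unique-⊑⇒length≤ (Uniq.filter⁺ _ (Γ-unique p)) (proj₁ ∘ ∈-filter⁻ (_∈? U) {xs = Γ p})) (Γ-short p)

  ∑-ports : ∀ S (f : Port → ℕ) → ∑ (ports S) f ≡ ∑ S (λ i → f (i , false) + f (i , true))
  ∑-ports [] f = refl
  ∑-ports (i ∷ S) f = trans (cong (λ z → f (i , false) + (f (i , true) + z)) (∑-ports S f)) (sym (+-assoc (f (i , false)) _ _))

  remove-sink : ∀ U t ps → ∑ ps (length ∘ nbrs U) ≤
    ∑ ps (length ∘ nbrs (delete Fin._≟_ t U)) + length (filter (λ p → t ∈? Γ p) ps)
  remove-sink U t [] = z≤n
  remove-sink U t (p ∷ ps) with t ∈? Γ p | remove-sink U t ps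
  ... | yes t∈ | ih = ≤-trans (+-mono-≤ (unique-⊑⇒length≤ {ys = t ∷ nbrs (delete Fin._≟_ t U) p} (Uniq.filter⁺ _ (Γ-unique p)) sub) ih)
                        (≤-reflexive (regroup (length (nbrs U′ p)) (∑ ps (length ∘ nbrs U′)) (length (filter (λ p → t ∈? Γ p) ps))))
    where
    U′ = delete Fin._≟_ t U
    regroup : ∀ a b c → suc a + (b + c) ≡ (a + b) + suc c
    regroup = solve-∀
    sub : nbrs U p ⊑ (t ∷ nbrs (delete Fin._≟_ t U) p)
    sub {z} z∈ with z Fin.≟ t | ∈-filter⁻ (_∈? U) {xs = Γ p} z∈
    ... | yes eq | _ = here eq
    ... | no ne | zΓ , zT = there (∈-filter⁺ (_∈? delete Fin._≟_ t U) zΓ (∈-delete⁺ Fin._≟_ zT ne))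
  ... | no t∉ | ih = ≤-trans (+-mono-≤ (unique-⊑⇒length≤ {ys = nbrs (delete Fin._≟_ t U) p} (Uniq.filter⁺ _ (Γ-unique p)) sub) ih)
                        (≤-reflexive (sym (+-assoc (length (nbrs U′ p)) (∑ ps (length ∘ nbrs U′)) (length (filter (λ p → t ∈? Γ p) ps)))))
    where
    U′ = delete Fin._≟_ t U
    sub : nbrs U p ⊑ nbrs (delete Fin._≟_ t U) p
    sub {z} z∈ with ∈-filter⁻ (_∈? U) {xs = Γ p} z∈
    ... | zΓ , zT = ∈-filter⁺ (_∈? delete Fin._≟_ t U) zΓ (∈-delete⁺ Fin._≟_ zT (λ { refl → t∉ zΓ }))

  -- The strict inequality is an invariant. A spider with a port of degree at most `c` carries at
  -- most `c + (c + c)` edges, since its other port has at most `c + c`; a poor sink carries at most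
  -- `β`. Either deletion keeps `edges` ahead, so `S` never runs empty.
  prune : ∀ fuel S U → Unique S → length S + length U ≤ fuel →
    (c + c + c) * length S + β * length U < edges S U → Pruned
  prune fuel S U uS size rich
    with any? (λ i → any? (λ κ → length (nbrs U (i , κ)) ≤? c) bools) S
       | any? (λ t → length (hosts S t) ≤? β) U
  prune zero S U uS size rich | yes a | _ with S
  ... | [] = ⊥-elim (¬Any[] a)
  prune (suc fuel) S U uS size rich | yes a | _ with find a
  ... | i , i∈ , poor = prune fuel S′ U (delete-unique I≟ uS)
      (≤-pred (<-≤-trans (+-monoˡ-< (length U) (length-delete I≟ i∈)) size))
      (+-cancelˡ-< (c + c + c) _ _ (begin-strict
        (c + c + c) + ((c + c + c) * length S′ + β * length U) ≡⟨ regroup (c + c + c) (length S′) _ ⟩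
        (c + c + c) * suc (length S′) + β * length U ≤⟨ +-monoˡ-≤ _ (*-monoʳ-≤ (c + c + c) (length-delete I≟ i∈)) ⟩
        (c + c + c) * length S + β * length U <⟨ rich ⟩
        edges S U ≡⟨ ∑-ports S f ⟩
        ∑ S g ≡⟨ ∑-delete I≟ g uS i∈ ⟩
        g i + ∑ S′ g ≡⟨ cong (g i +_) (∑-ports S′ f) ⟨
        g i + edges S′ U ≤⟨ +-monoˡ-≤ _ (few (find poor)) ⟩
        (c + c + c) + edges S′ U ∎))
    where
    open ≤-Reasoning
    I≟ = Fin._≟_ {ℓ}
    S′ = delete I≟ i S
    f : Port → ℕ
    f = length ∘ nbrs U
    g : I → ℕ
    g i = f (i , false) + f (i , true)
    regroup : ∀ a s t → a + (a * s + t) ≡ a * suc s + t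
    regroup = solve-∀
    few : (∃ λ κ → κ ∈ bools × length (nbrs U (i , κ)) ≤ c) → g i ≤ c + c + c
    few (false , _ , le) = ≤-trans (+-mono-≤ le (nbrs-short U (i , true))) (≤-reflexive (sym (+-assoc c c c)))
    few (true , _ , le) = +-mono-≤ (nbrs-short U (i , false)) le
  prune zero S U uS size rich | no _ | yes a with U | ≤-trans (m≤n+m (length U) (length S)) size
  ... | [] | _ = ⊥-elim (¬Any[] a)
  prune (suc fuel) S U uS size rich | no _ | yes a with find a
  ... | t , t∈ , poor = prune fuel S U′ uS
      (≤-pred (<-≤-trans (+-monoʳ-< (length S) (length-delete Fin._≟_ t∈)) size))
      (+-cancelʳ-< β _ _ (begin-strict
        (c + c + c) * length S + β * length U′ + β ≡⟨ regroup _ β (length U′) ⟩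
        (c + c + c) * length S + β * suc (length U′) ≤⟨ +-monoʳ-≤ ((c + c + c) * length S) (*-monoʳ-≤ β (length-delete Fin._≟_ t∈)) ⟩
        (c + c + c) * length S + β * length U <⟨ rich ⟩
        edges S U ≤⟨ remove-sink U t (ports S) ⟩
        edges S U′ + length (hosts S t) ≤⟨ +-monoʳ-≤ (edges S U′) poor ⟩
        edges S U′ + β ∎))
    where
    open ≤-Reasoning
    U′ = delete Fin._≟_ t U
    regroup : ∀ a b t → a + b * t + b ≡ a + b * suc t
    regroup = solve-∀
  prune fuel [] U uS size () | no _ | no _
  prune fuel S@(i ∷ _) U uS size rich | no ports-rich | no sinks-rich = record
    { S = S ; U = U ; S-unique = uS ; root = i ; root∈ = here refl
    ; port-deg = λ κ i∈ → ≰⇒> (λ le → ports-rich (lose i∈ (lose (∈-bools κ) le)))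
    ; sink-deg = λ t∈ → ≰⇒> (λ le → sinks-rich (lose t∈ le)) }

  module Chains (P : Pruned) (verts : I → List V) (k : ℕ) (length-verts : ∀ i → length (verts i) ≡ k)
    (apart : ∀ {i j v} → v ∈ verts i → v ∈ verts j → i ≡ j) where

    open Pruned P

    -- The spiders lam j, joined consecutively through the sinks τ j; o j is the port of lam j
    -- facing the beginning of the chain.
    record Chain (m : ℕ) : Set where
      field
        lam     : Fin (suc m) → I
        o       : Fin (suc m) → Bool
        τ       : Fin m → V
        lam∈    : ∀ i → lam i ∈ S
        lam-inj : ∀ {i j} → lam i ≡ lam j → i ≡ j
        τ-inj   : ∀ {i j} → τ i ≡ τ j → i ≡ j
        before  : ∀ j → τ j ∈ Γ (lam (inject₁ j) , not (o (inject₁ j)))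
        after   : ∀ j → τ j ∈ Γ (lam (suc j) , o (suc j))
        clear   : ∀ j i → τ j ∉ verts (lam i)

    -- The default `root` for vertices outside all spiders is harmless: at worst it bars one more
    -- spider from being chosen in `chain`.
    host : V → I
    host v with Fin.any? (λ i → v ∈? verts i)
    ... | yes (i , _) = i
    ... | no _ = root

    host≡ : ∀ {v i} → v ∈ verts i → host v ≡ i
    host≡ {v} {i} v∈ with Fin.any? (λ i → v ∈? verts i)
    ... | yes (j , v∈′) = apart v∈′ v∈
    ... | no none = ⊥-elim (none (i , v∈))

    -- The chain grows at its front. The open port `o zero` has more than `c` sinks, enough to avoid
    -- the spiders and sinks already present. The new sink `t` has more than `β` ports, enough to
    -- avoid both ports of every spider that is in the chain or contains one of its sinks: with
    -- `suc m` spiders and, counting `t`, `suc m` sinks, these are `suc m * 4` ports.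
    chain : ∀ m → suc m * k + m ≤ c → suc m * 4 ≤ β → Chain m
    chain zero _ _ = record
      { lam = λ _ → root ; o = λ _ → true ; τ = λ () ; lam∈ = λ _ → root∈ ; lam-inj = λ { {zero} {zero} _ → refl }
      ; τ-inj = λ { {()} } ; before = λ () ; after = λ () ; clear = λ () }
    chain (suc m) c≥ β≥ = cons
      where
      C = chain m (≤-trans (+-mono-≤ (m≤n+m (suc m * k) k) (n≤1+n m)) c≥) (≤-trans (m≤n+m (suc m * 4) 4) β≥)
      open Chain C
      blocked : List V
      blocked = concatMap (verts ∘ lam) (allFin (suc m)) ++ map τ (allFin m)
      length-blocked : length blocked ≤ c
      length-blocked = ≤-trans (≤-trans (≤-reflexive (length-++ (concatMap (verts ∘ lam) (allFin (suc m))))) (+-mono-≤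
          (≤-trans (length-concatMap≤ (verts ∘ lam) k (λ i → ≤-reflexive (length-verts (lam i))) (allFin (suc m)))
                   (≤-reflexive (cong (_* k) (length-allFin (suc m)))))
          (≤-reflexive (trans (length-map τ (allFin m)) (length-allFin m)))))
        (≤-trans (+-mono-≤ (m≤n+m (suc m * k) k) (n≤1+n m)) c≥)
      sink = pick Fin._≟_ {ys = blocked} (Uniq.filter⁺ (_∈? U) (Γ-unique (lam zero , o zero)))
               (≤-<-trans length-blocked (port-deg (o zero) (lam∈ zero)))
      t = proj₁ sink
      t∈ = ∈-filter⁻ (_∈? U) {xs = Γ (lam zero , o zero)} (proj₁ (proj₂ sink))
      used : List I
      used = map lam (allFin (suc m)) ++ map host (t ∷ map τ (allFin m))
      length-used : length (cartesianProduct used bools) ≤ β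
      length-used = ≤-trans (≤-reflexive (trans (length-×bools used) (cong (_* 2) (trans (length-++ (map lam (allFin (suc m)))) (cong₂ _+_
          (trans (length-map lam (allFin (suc m))) (length-allFin (suc m)))
          (trans (length-map host (t ∷ map τ (allFin m))) (cong suc (trans (length-map τ (allFin m)) (length-allFin m)))))))))
        (≤-trans (≤-reflexive (double (suc m))) (≤-trans (m≤n+m (suc m * 4) 4) β≥))
        where
        double : ∀ m → (m + m) * 2 ≡ m * 4
        double = solve-∀
      source = pick (Product.≡-dec Fin._≟_ Bool._≟_) {ys = cartesianProduct used bools}
                 (Uniq.filter⁺ (λ p → t ∈? Γ p) (×bools-unique S-unique)) (≤-<-trans length-used (sink-deg (proj₂ t∈)))
      i′ = proj₁ (proj₁ source)
      κ′ = proj₂ (proj₁ source)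
      source∈ = ∈-filter⁻ (λ p → t ∈? Γ p) {xs = ports S} (proj₁ (proj₂ source))
      fresh : i′ ∉ used
      fresh i′∈ = proj₂ (proj₂ source) (∈-cartesianProduct⁺ i′∈ (∈-bools κ′))
      fresh-lam : ∀ i → i′ ≢ lam i
      fresh-lam i eq = fresh (∈-++⁺ˡ (subst (_∈ map lam (allFin (suc m))) (sym eq) (∈-map⁺ lam (∈-allFin i))))
      fresh-host : ∀ {v} → v ∈ t ∷ map τ (allFin m) → v ∉ verts i′
      fresh-host v∈ v∈i = fresh (∈-++⁺ʳ (map lam (allFin (suc m))) (subst (_∈ _) (host≡ v∈i) (∈-map⁺ host v∈)))
      t-clear : ∀ i → t ∉ verts (lam i)
      t-clear i t∈i = proj₂ (proj₂ sink) (∈-++⁺ˡ (∈-concatMap⁺ (verts ∘ lam) {xs = allFin (suc m)} (lose (∈-allFin i) t∈i)))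
      t-fresh : ∀ j → t ≢ τ j
      t-fresh j eq = proj₂ (proj₂ sink) (∈-++⁺ʳ (concatMap (verts ∘ lam) (allFin (suc m)))
        (subst (_∈ map τ (allFin m)) (sym eq) (∈-map⁺ τ (∈-allFin j))))
      lam′ : Fin (suc (suc m)) → I
      lam′ zero = i′
      lam′ (suc i) = lam i
      o′ : Fin (suc (suc m)) → Bool
      -- The new spider meets `t` through port `κ′`, so the opposite port is the open one.
      o′ zero = not κ′
      o′ (suc i) = o i
      τ′ : Fin (suc m) → V
      τ′ zero = t
      τ′ (suc j) = τ j
      lam∈′ : ∀ i → lam′ i ∈ S
      lam∈′ zero = proj₁ (∈-cartesianProduct⁻ S bools (proj₁ source∈))
      lam∈′ (suc i) = lam∈ i
      lam-inj′ : ∀ i j → lam′ i ≡ lam′ j → i ≡ j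
      lam-inj′ zero zero _ = refl
      lam-inj′ zero (suc j) eq = ⊥-elim (fresh-lam j eq)
      lam-inj′ (suc i) zero eq = ⊥-elim (fresh-lam i (sym eq))
      lam-inj′ (suc i) (suc j) eq = cong suc (lam-inj eq)
      τ-inj′ : ∀ i j → τ′ i ≡ τ′ j → i ≡ j
      τ-inj′ zero zero _ = refl
      τ-inj′ zero (suc j) eq = ⊥-elim (t-fresh j eq)
      τ-inj′ (suc i) zero eq = ⊥-elim (t-fresh i (sym eq))
      τ-inj′ (suc i) (suc j) eq = cong suc (τ-inj eq)
      before′ : ∀ j → τ′ j ∈ Γ (lam′ (inject₁ j) , not (o′ (inject₁ j)))
      before′ zero = subst (λ κ → t ∈ Γ (i′ , κ)) (sym (Bool.not-involutive κ′)) (proj₂ source∈)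
      before′ (suc j) = before j
      after′ : ∀ j → τ′ j ∈ Γ (lam′ (suc j) , o′ (suc j))
      after′ zero = proj₁ t∈
      after′ (suc j) = after j
      clear′ : ∀ j i → τ′ j ∉ verts (lam′ i)
      clear′ zero zero = fresh-host (here refl)
      clear′ zero (suc i) = t-clear i
      clear′ (suc j) zero = fresh-host (there (∈-map⁺ τ (∈-allFin j)))
      clear′ (suc j) (suc i) = clear j i
      cons : Chain (suc m)
      cons = record
        { lam = lam′ ; o = o′ ; τ = τ′ ; lam∈ = lam∈′ ; lam-inj = λ {i} {j} → lam-inj′ i j ; τ-inj = λ {i} {j} → τ-inj′ i j
        ; before = before′ ; after = after′ ; clear = clear′ }

-- Two disjoint joins between coloured linkages

module Joining {V : Set} (_≟_ : DecidableEquality V) {E : V → V → Set} {C₁ C₂ : Set}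
  (_≟₂_ : DecidableEquality C₂) {l m : ℕ}
  (srcL dstL : Fin l → V) (L : Fin l → List V) (walkL : ∀ i → Walk E (srcL i) (dstL i) (L i))
  (apartL : ∀ {i j v} → v ∈ L i → v ∈ L j → i ≡ j) (colL : Fin l → C₁)
  (srcM dstM : Fin m → V) (M : Fin m → List V) (walkM : ∀ i → Walk E (srcM i) (dstM i) (M i))
  (uniqueL : ∀ i → Unique (L i)) (uniqueM : ∀ i → Unique (M i))
  (apartM : ∀ {i j v} → v ∈ M i → v ∈ M j → i ≡ j) (colM : Fin m → C₂) where

  open import Data.List.Membership.DecPropositional _≟_ using (_∈?_)

  record Join : Set where
    constructor mkJoin
    field
      i j  : _
      v    : V
      xs   : List V
      ys   : List V
      p    : Walk E (srcL i) v xs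
      q    : Walk E (srcM j) v ys
      up   : Unique xs
      uq   : Unique ys
      xs⊑  : xs ⊑ L i
      ys⊑  : ys ⊑ M j
      meet : ∀ {z} → z ∈ xs → z ∈ ys → z ≡ v

  record TwoJoins (c c′ : C₁) : Set where
    constructor mkTwo
    field
      G G′ : Join
      colJ : colL (Join.i G) ≡ c
      colJ′ : colL (Join.i G′) ≡ c′
      col≢ : colM (Join.j G) ≢ colM (Join.j G′)
      cross  : Join.xs G ∥ Join.ys G′
      cross′ : Join.xs G′ ∥ Join.ys G

  swapJoins : ∀ {c c′} → TwoJoins c c′ → TwoJoins c′ c
  swapJoins (mkTwo G G′ a b n x y) = mkTwo G′ G b a (n ∘ sym) y x

  record Approach (i : Fin l) : Set where
    field
      v    : V
      xs   : List V
      p    : Walk E (srcL i) v xs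
      up   : Unique xs
      xs⊑  : xs ⊑ L i
      j    : Fin m
      v∈   : v ∈ M j
      only : ∀ {z j} → z ∈ xs → z ∈ M j → z ≡ v

  approach : ∀ {i} {w} {ws} → Walk E (srcL i) w ws → Unique ws → ws ⊑ L i →
    (∃ λ z → z ∈ ws × ∃ λ j → z ∈ M j) → Σ (Approach i) λ a → Approach.v a ∈ ws × Approach.xs a ⊑ ws
  approach w u sub hit =
    let c = firstHit (λ z → Fin.any? (λ j → z ∈? M j)) w hit
        open Cut c renaming (hit to hitc)
    in record { v = mid ; xs = pre ; p = before ; up = pre-unique u ; xs⊑ = λ z∈ → sub (pre⊑ z∈)
              ; j = proj₁ hitc ; v∈ = proj₂ hitc ; only = λ z∈ zM → only z∈ (_ , zM) }
       , pre⊑ (walk-dst before) , pre⊑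

  joinOf : ∀ {i} → Approach i → Join
  joinOf {i} a = record { i = i ; j = a.j ; v = a.v ; xs = a.xs ; ys = C.pre ; p = a.p ; q = upTo cut
      ; up = a.up ; uq = C.pre-unique (uniqueM a.j) ; xs⊑ = a.xs⊑ ; ys⊑ = C.pre⊑ ; meet = λ z∈ z∈′ → a.only z∈ (C.pre⊑ z∈′) }
    where
    module a = Approach a
    cut = splitAt∈ _≟_ (walkM a.j) a.v∈
    module C = Cut cut

  joinApproaches : ∀ {i i′} (a : Approach i) (a′ : Approach i′) → colM (Approach.j a) ≢ colM (Approach.j a′) →
    TwoJoins (colL i) (colL i′)
  joinApproaches {i} {i′} a a′ ne = mkTwo (joinOf a) (joinOf a′) refl refl ne
      (λ z∈ z∈′ → clash a a′ ne z∈ (Join.ys⊑ (joinOf a′) z∈′))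
      (λ z∈ z∈′ → clash a′ a (ne ∘ sym) z∈ (Join.ys⊑ (joinOf a) z∈′))
    where
    clash : ∀ {i i′} (a : Approach i) (a′ : Approach i′) → colM (Approach.j a) ≢ colM (Approach.j a′) →
      ∀ {z} → z ∈ Approach.xs a → z ∈ M (Approach.j a′) → ⊥
    clash a a′ ne z∈ z∈′ with Approach.only a z∈ z∈′
    ... | refl = ne (cong colM (apartM (Approach.v∈ a) z∈′))

  -- Unlike an `Approach`, this part of `L i` may cross paths of `M` of colour `c`; it stops only at
  -- a path of another colour.
  record Initial (c : C₂) (i : Fin l) : Set where
    field
      v    : V
      xs   : List V
      p    : Walk E (srcL i) v xs
      up   : Unique xs
      xs⊑  : xs ⊑ L i
      j    : Fin m
      v∈   : v ∈ M j
      j≢   : colM j ≢ c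
      only : ∀ {z j} → z ∈ xs → z ∈ M j → colM j ≢ c → z ≡ v

  initial : ∀ c i → (∃ λ j → colM j ≢ c × dstL i ∈ M j) → Initial c i
  initial c i (j , ne , d∈) = record
      { v = mid ; xs = pre ; p = before ; up = pre-unique (uniqueL i) ; xs⊑ = pre⊑
      ; j = proj₁ hit ; v∈ = proj₂ (proj₂ hit) ; j≢ = proj₁ (proj₂ hit) ; only = λ z∈ zM ne → only z∈ (_ , ne , zM) }
    where
    open Cut (firstHit (λ z → Fin.any? (λ j → ¬? (colM j ≟₂ c) ×-dec (z ∈? M j))) (walkL i)
      (dstL i , walk-dst (walkL i) , j , ne , d∈))

  private
    -- q, the first vertex of M p on one of the two initial parts, lies on the first of them.
    finish : ∀ {c i i′} (I : Initial c i) (I′ : Initial c i′) → colL i ≢ colL i′ → ∀ {p} → colM p ≡ c →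
      (C : Cut {E = E} (srcM p) (dstM p) (M p) (λ z → z ∈ Initial.xs I ⊎ z ∈ Initial.xs I′)) →
      Cut.mid C ∈ Initial.xs I → TwoJoins (colL i) (colL i′)
    finish {c} {i} {i′} I I′ col {p} col-p C q∈ = mkTwo
        (mkJoin i p C.mid D.pre C.pre (upTo cutD) C.before (D.pre-unique I.up)
          (C.pre-unique (uniqueM p)) (I.xs⊑ ∘ D.pre⊑) C.pre⊑ (λ z∈ z∈′ → C.only z∈′ (inj₁ (D.pre⊑ z∈))))
        (mkJoin i′ I′.j I′.v I′.xs D′.pre I′.p (upTo cutD′) I′.up
          (D′.pre-unique (uniqueM I′.j)) I′.xs⊑ D′.pre⊑ (λ z∈ z∈′ → I′.only z∈ (D′.pre⊑ z∈′) I′.j≢))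
        refl refl (λ eq → I′.j≢ (trans (sym eq) col-p))
        cross cross′
      where
      module I = Initial I
      module I′ = Initial I′
      module C = Cut C
      cutD = splitAt∈ _≟_ I.p q∈
      cutD′ = splitAt∈ _≟_ (walkM I′.j) I′.v∈
      module D = Cut cutD
      module D′ = Cut cutD′
      q∈M : C.mid ∈ M p
      q∈M = C.pre⊑ (walk-dst C.before)
      -- `I.v` ends `I.xs`, so it lies on the part up to `q` only if it equals `q`; but `q` is on a
      -- path of colour `c`, and `I.v` on one of another colour.
      v∈D→⊥ : I.v ∈ D.pre → ⊥
      v∈D→⊥ v∈ with walk-dst D.after
      ... | here eq = I.j≢ (trans (cong colM (apartM (subst (_∈ M I.j) (trans eq D.hit) I.v∈) q∈M)) col-p)
      ... | there v∈′ = D.disjoint I.up v∈ v∈′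
      cross : D.pre ∥ D′.pre
      cross z∈ z∈′ = v∈D→⊥ (subst (_∈ D.pre) (I.only (D.pre⊑ z∈) (D′.pre⊑ z∈′) I′.j≢) z∈)
      cross′ : I′.xs ∥ C.pre
      cross′ z∈ z∈′ with C.only z∈′ (inj₂ z∈)
      ... | refl = col (cong colL (apartL (I.xs⊑ q∈) (I′.xs⊑ z∈)))

  -- Follow one path of each colour to its first vertex on `M`. If both hits have the same colour
  -- `e`, take paths `k` and `k′` ending on colours other than `e`, cut where they first meet such a
  -- colour. If the first hit of `k` has a colour other than `e`, it pairs with the old hit of
  -- `k′`'s colour class. Otherwise `k` crosses a path of `M` of colour `e`; the first vertex of
  -- that path on either cut part yields one join, and the other cut part, followed to its end,
  -- yields the second.
  twoJoins : ∀ {c c′} → c ≢ c′ → C₂ →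
    (∀ (e : C₂) → ∃ λ i → colL i ≡ c × ∃ λ j → colM j ≢ e × dstL i ∈ M j) →
    (∀ (e : C₂) → ∃ λ i → colL i ≡ c′ × ∃ λ j → colM j ≢ e × dstL i ∈ M j) → TwoJoins c c′
  twoJoins {c} {c′} c≢c′ e₀ ends ends′ = result
    where
    full : ∀ {i} → (∃ λ j → colM j ≢ e₀ × dstL i ∈ M j) → Approach i
    full {i} (j , _ , d∈) = proj₁ (approach (walkL i) (uniqueL i) id (dstL i , walk-dst (walkL i) , j , d∈))
    retype : ∀ {i i′} → colL i ≡ c → colL i′ ≡ c′ → TwoJoins (colL i) (colL i′) → TwoJoins c c′
    retype refl refl t = t
    retype′ : ∀ {i i′} → colL i ≡ c → colL i′ ≡ c′ → TwoJoins (colL i′) (colL i) → TwoJoins c c′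
    retype′ refl refl t = swapJoins t

    result : TwoJoins c c′
    result with ends e₀ | ends′ e₀
    ... | i , ci , x | i′ , ci′ , x′ with colM (Approach.j (full x)) ≟₂ colM (Approach.j (full x′))
    ... | no ne = retype ci ci′ (joinApproaches (full x) (full x′) ne)
    ... | yes same with colM (Approach.j (full x)) in eq
    ... | e with ends e | ends′ e
    ... | k , ck , y | k′ , ck′ , y′ = second
      where
      I = initial e k y
      I′ = initial e k′ y′
      module I = Initial I
      module I′ = Initial I′
      ap = approach I.p I.up I.xs⊑ (I.v , walk-dst I.p , I.j , I.v∈)
      a = proj₁ ap
      module a = Approach a
      second : TwoJoins c c′
      second with colM a.j ≟₂ e
      ... | no ne = retype ck ci′ (joinApproaches a (full x′) (λ q → ne (trans q (sym same))))
      ... | yes col-p with firstHit (λ z → (z ∈? I.xs) ⊎-dec (z ∈? I′.xs)) (walkM a.j) (a.v , a.v∈ , inj₁ (proj₁ (proj₂ ap)))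
      ... | C with Cut.hit C
      ... | inj₁ q∈ = retype ck ck′ (finish I I′ (λ q → c≢c′ (trans (sym ck) (trans q ck′))) col-p C q∈)
      ... | inj₂ q∈ = retype′ ck ck′ (finish I′ I (λ q → c≢c′ (trans (sym ck) (trans (sym q) ck′))) col-p
                        record { pre = Cut.pre C ; post = Cut.post C ; before = Cut.before C ; after = Cut.after C
                               ; split = Cut.split C ; hit = [ inj₂ , inj₁ ]′ (Cut.hit C)
                               ; only = λ z∈ h → Cut.only C z∈ ([ inj₂ , inj₁ ]′ h) } q∈)

open import Defs

-- From walks to a subdivision

record Trace {V : Set} (E : V → V → Set) (u v : V) (xs : List V) (l : ℕ) : Set where
  field
    at     : Fin (suc l) → V
    at-inj : ∀ {i j} → at i ≡ at j → i ≡ j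
    at∈    : ∀ i → at i ∈ xs
    first  : at zero ≡ u
    final  : at (fromℕ l) ≡ v
    steps  : ∀ (i : Fin l) → E (at (inject₁ i)) (at (suc i))

trace : ∀ {V : Set} {E : V → V → Set} {u v xs l} → Walk E u v xs → Unique xs → length xs ≡ suc l → Trace E u v xs l
trace {u = u} [] _ refl = record
  { at = λ _ → u ; at-inj = λ { {zero} {zero} _ → refl } ; at∈ = λ _ → here refl ; first = refl ; final = refl ; steps = λ () }
trace {l = zero} (_ ∷ []) _ ()
trace {l = zero} (_ ∷ (_ ∷ _)) _ ()
trace {E = E} {u = u} {xs = u ∷ xs} {l = suc l} (e ∷ p) un@(_ ∷ un′) eq = record
  { at = at ; at-inj = λ {i} {j} → at-inj i j ; at∈ = at∈ ; first = refl ; final = R.final ; steps = steps }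
  where
  module R = Trace (trace p un′ (suc-injective eq))
  at : Fin (suc (suc l)) → _
  at zero = u
  at (suc i) = R.at i
  at-inj : ∀ i j → at i ≡ at j → i ≡ j
  at-inj zero zero _ = refl
  at-inj zero (suc j) eq = ⊥-elim (head-∉ un (subst (_∈ xs) (sym eq) (R.at∈ j)))
  at-inj (suc i) zero eq = ⊥-elim (head-∉ un (subst (_∈ xs) eq (R.at∈ i)))
  at-inj (suc i) (suc j) eq = cong suc (R.at-inj eq)
  at∈ : ∀ i → at i ∈ u ∷ xs
  at∈ zero = here refl
  at∈ (suc i) = there (R.at∈ i)
  steps : ∀ i → E (at (inject₁ i)) (at (suc i))
  steps zero = subst (E u) (sym R.first) e
  steps (suc i) = R.steps i

walk-length : ∀ {V : Set} {E : V → V → Set} {u v xs} → Walk E u v xs → length xs ≡ suc (length xs ∸ 1)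
walk-length [] = refl
walk-length (_ ∷ _) = refl

module _ (D : Digraph) {x y u v : Fin (n D)} (x≡ : x ≡ u) (y≡ : y ≡ v) {xs : List (Fin (n D))}
  (p : Walk (Adj (adj D)) u v xs) (un : Unique xs) where

  open Trace (trace p un (walk-length p))

  toPath : Path D x y
  toPath = record { len = _ ; vtx = at ; inj = at-inj ; start = trans first (sym x≡) ; finish = trans final (sym y≡) ; arcs = steps }

  internal⁻ : ∀ {w} → Internal toPath w → w ∈ xs × w ≢ u × w ≢ v
  internal⁻ (k , 0<k , k<l , refl) = at∈ k
    , (λ eq → <⇒≢ 0<k (sym (cong toℕ (at-inj {k} {zero} (trans eq (sym first))))))
    , (λ eq → <⇒≢ k<l (trans (cong toℕ (at-inj {k} {fromℕ _} (trans eq (sym final)))) (Fin.toℕ-fromℕ _)))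

prev : ∀ {a} → Fin (suc a) → Fin (suc a)
prev zero = fromℕ _
prev (suc i) = inject₁ i

prev-next : ∀ {a} (i : Fin (suc a)) → prev (next i) ≡ i
prev-next {a} i with suc (toℕ i) <? suc a
... | yes lt = go (next i) (trans (Fin.toℕ-fromℕ< _) (m<n⇒m%n≡m lt))
  where
  go : ∀ c → toℕ c ≡ suc (toℕ i) → prev c ≡ i
  go (suc c) eq = Fin.toℕ-injective (trans (Fin.toℕ-inject₁ c) (suc-injective eq))
... | no ¬lt = go (next i) (trans (Fin.toℕ-fromℕ< _) (trans (cong (_% suc a) last) (n%n≡0 (suc a))))
  where
  last : suc (toℕ i) ≡ suc a
  last = ≤-antisym (Fin.toℕ<n i) (≮⇒≥ ¬lt)
  go : ∀ c → toℕ c ≡ 0 → prev c ≡ i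
  go zero _ = Fin.toℕ-injective (trans (Fin.toℕ-fromℕ a) (suc-injective (sym last)))

-- The sink goal c is the meeting point of the tails continuing the arms (c , false) and (prev c , true).
record Frame (D : Digraph) (a b : ℕ) : Set where
  V = Fin (n D)
  field
    hub         : Fin (suc a) → V
    arm       : Fin (suc a) → Bool → List V
    z         : Fin (suc a) → Bool → V
    armWalk   : ∀ i κ → Walk (Adj (adj D)) (hub i) (z i κ) (hub i ∷ arm i κ)
    armUnique : ∀ i κ → Unique (hub i ∷ arm i κ)
    armLength : ∀ i κ → length (arm i κ) ≡ b
    armApart  : ∀ {i j κ ι v} → v ∈ hub i ∷ arm i κ → v ∈ hub j ∷ arm j ι → i ≡ j
    armSplit  : ∀ {i κ ι v} → v ∈ arm i κ → v ∈ arm i ι → κ ≡ ι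
    goal         : Fin (suc a) → V
    f         : Fin (suc a) → Bool → V
    tail      : Fin (suc a) → Bool → List V
    tailWalk  : ∀ c κ → Walk (Adj (adj D)) (f c κ) (goal c) (tail c κ)
    tailUnique : ∀ c κ → Unique (tail c κ)
    linkˡ     : ∀ c → Adj (adj D) (z c false) (f c false)
    linkʳ     : ∀ c → Adj (adj D) (z (prev c) true) (f c true)
    armTail   : ∀ {i κ c ι v} → v ∈ hub i ∷ arm i κ → v ∈ tail c ι → ⊥
    tailApart : ∀ {c c′ κ ι v} → v ∈ tail c κ → v ∈ tail c′ ι → c ≡ c′
    tailMeet  : ∀ {c v} → v ∈ tail c false → v ∈ tail c true → v ≡ goal c

step-inject₁ : ∀ b (p : Fin b) → step (suc b) (inject₁ p) ≡ just p
step-inject₁ (suc b) zero = refl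
step-inject₁ (suc b) (suc p) = cong (Maybe.map suc) (step-inject₁ b p)

step-fromℕ : ∀ b → step (suc b) (fromℕ b) ≡ nothing
step-fromℕ zero = refl
step-fromℕ (suc b) = cong (Maybe.map suc) (step-fromℕ b)

module _ {D : Digraph} {a b : ℕ} (F : Frame D a (suc b)) where

  open Frame F

  private
    module A (i : Fin (suc a)) (κ : Bool) =
      Trace (trace (armWalk i κ) (armUnique i κ) (cong suc (armLength i κ)))
    at : Fin (suc a) → Bool → Fin (suc (suc b)) → V
    at = A.at

    C : Set
    C = CVertex (suc a) (suc b)

    φ : C → V
    φ (s i) = hub i
    φ (t i) = goal i
    φ (mid i κ p) = at i κ (suc (inject₁ p))

    sink : Fin (suc a) → Bool → Fin (suc a)
    sink i false = i
    sink i true = next i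

    sink-inj : ∀ i j κ → sink i κ ≡ sink j κ → i ≡ j
    sink-inj i j false eq = eq
    sink-inj i j true eq = trans (sym (prev-next i)) (trans (cong prev eq) (prev-next j))

    φ-end : ∀ i κ → φ (pathEnd {b = suc b} i κ) ≡ goal (sink i κ)
    φ-end i false = refl
    φ-end i true = refl

    link : ∀ i κ → Adj (adj D) (z i κ) (f (sink i κ) κ)
    link i false = linkˡ i
    link i true = subst (λ j → Adj (adj D) (z j true) (f (next i) true)) (prev-next i) (linkʳ (next i))

    φ-src : ∀ i κ k → φ (pv i κ (inject₁ k)) ≡ at i κ (inject₁ k)
    φ-src i κ zero = sym (A.first i κ)
    φ-src i κ (suc k) rewrite step-inject₁ b k = refl

    φ-mid : ∀ i κ p → φ (pv i κ (suc (inject₁ p))) ≡ at i κ (suc (inject₁ p))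
    φ-mid i κ p rewrite step-inject₁ b p = refl

    φ-last : ∀ i κ → φ (pv i κ (suc (fromℕ b))) ≡ goal (sink i κ)
    φ-last i κ rewrite step-fromℕ b = φ-end i κ

    at-arm : ∀ i κ k → at i κ (suc k) ∈ arm i κ
    at-arm i κ k with A.at∈ i κ (suc k)
    ... | there p = p
    ... | here eq with A.at-inj i κ {suc k} {zero} (trans eq (sym (A.first i κ)))
    ... | ()

    z-arm : ∀ i κ → z i κ ∈ arm i κ
    z-arm i κ = subst (_∈ arm i κ) (A.final i κ) (at-arm i κ (fromℕ b))

    s∉arm : ∀ {i κ} → hub i ∉ arm i κ
    s∉arm {i} {κ} = head-∉ (armUnique i κ)

    t∈tail : ∀ c κ → goal c ∈ tail c κ
    t∈tail c κ = walk-dst (tailWalk c κ)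

    last : Fin (suc a) → Bool → V
    last i κ = at i κ (inject₁ (fromℕ b))

    endWalk : ∀ i κ → Walk (Adj (adj D)) (last i κ) (goal (sink i κ)) (last i κ ∷ z i κ ∷ tail (sink i κ) κ)
    endWalk i κ = subst (Adj (adj D) (last i κ)) (A.final i κ) (A.steps i κ (fromℕ b)) ∷ link i κ ∷ tailWalk (sink i κ) κ

    endUnique : ∀ i κ → Unique (last i κ ∷ z i κ ∷ tail (sink i κ) κ)
    endUnique i κ = unique-∷ fresh (unique-∷ (armTail (there (z-arm i κ))) (tailUnique (sink i κ) κ))
      where
      fresh : last i κ ∉ z i κ ∷ tail (sink i κ) κ
      fresh (here eq) = <⇒≢ (≤-refl {suc b}) (trans (sym (trans (Fin.toℕ-inject₁ (fromℕ b)) (Fin.toℕ-fromℕ b)))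
        (trans (cong toℕ (A.at-inj i κ {inject₁ (fromℕ b)} {fromℕ (suc b)} (trans eq (sym (A.final i κ))))) (Fin.toℕ-fromℕ (suc b))))
      fresh (there p) = armTail (A.at∈ i κ _) p

    stepUnique : ∀ i κ (k : Fin (suc b)) → Unique (at i κ (inject₁ k) ∷ at i κ (suc k) ∷ [])
    stepUnique i κ k = unique-∷ (λ { (here eq) → <⇒≢ (≤-refl {suc (toℕ k)})
      (trans (sym (Fin.toℕ-inject₁ k)) (cong toℕ (A.at-inj i κ eq))) }) (unique-∷ (λ ()) [])

    data Place : Fin (suc b) → Set where
      inner : ∀ p → Place (inject₁ p)
      outer : Place (fromℕ b)

    place : ∀ k → Place k
    place k with view k
    ... | ‵fromℕ = outer
    ... | ‵inject₁ p = inner p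

    -- A path of the pattern has `suc b` arcs, as many as an arm. All but the last become single
    -- arcs of the arm; the last carries the final arc of the arm, the link and the tail, and is
    -- thus the only one that can have internal vertices.
    segment : ∀ i κ {k} → Place k → Path D (φ (pv i κ (inject₁ k))) (φ (pv i κ (suc k)))
    segment i κ (inner p) = toPath D (φ-src i κ (inject₁ p)) (φ-mid i κ p) (A.steps i κ (inject₁ p) ∷ []) (stepUnique i κ (inject₁ p))
    segment i κ outer = toPath D (φ-src i κ (fromℕ b)) (φ-last i κ) (endWalk i κ) (endUnique i κ)

    segment-internal : ∀ i κ {k} (l : Place k) {w} → Internal (segment i κ l) w →
      k ≡ fromℕ b × (w ≡ z i κ ⊎ w ∈ tail (sink i κ) κ) × w ≢ goal (sink i κ)
    segment-internal i κ (inner p) int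
      with internal⁻ D (φ-src i κ (inject₁ p)) (φ-mid i κ p) (A.steps i κ (inject₁ p) ∷ []) (stepUnique i κ (inject₁ p)) int
    ... | here eq , ne , _ = ⊥-elim (ne eq)
    ... | there (here eq) , _ , ne = ⊥-elim (ne eq)
    segment-internal i κ outer int with internal⁻ D (φ-src i κ (fromℕ b)) (φ-last i κ) (endWalk i κ) (endUnique i κ) int
    ... | here eq , ne , _ = ⊥-elim (ne eq)
    ... | there (here eq) , _ , ne = refl , inj₁ eq , ne
    ... | there (there p) , _ , ne = refl , inj₂ p , ne

    φ-inj : ∀ u v → φ u ≡ φ v → u ≡ v
    φ-inj (s i) (s j) eq = cong s (armApart {κ = false} {ι = false} (here refl) (here eq))
    φ-inj (s i) (t j) eq = ⊥-elim (armTail {κ = false} (here (sym eq)) (t∈tail j false))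
    φ-inj (s i) (mid j κ p) eq with armApart {κ = κ} {ι = κ} (here (sym eq)) (there (at-arm j κ (inject₁ p)))
    ... | refl = ⊥-elim (s∉arm (subst (_∈ arm j κ) (sym eq) (at-arm j κ (inject₁ p))))
    φ-inj (t i) (s j) eq = ⊥-elim (armTail {κ = false} (here eq) (t∈tail i false))
    φ-inj (t i) (t j) eq = cong t (tailApart (t∈tail i false) (subst (_∈ tail j false) (sym eq) (t∈tail j false)))
    φ-inj (t i) (mid j κ p) eq = ⊥-elim (armTail (there (at-arm j κ (inject₁ p))) (subst (_∈ tail i false) eq (t∈tail i false)))
    φ-inj (mid i κ p) (s j) eq with armApart {κ = κ} {ι = κ} (here eq) (there (at-arm i κ (inject₁ p)))
    ... | refl = ⊥-elim (s∉arm (subst (_∈ arm i κ) eq (at-arm i κ (inject₁ p))))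
    φ-inj (mid i κ p) (t j) eq = ⊥-elim (armTail (there (at-arm i κ (inject₁ p))) (subst (_∈ tail j false) (sym eq) (t∈tail j false)))
    φ-inj (mid i κ p) (mid j ι q) eq
      with armApart (there (at-arm i κ (inject₁ p))) (there (subst (_∈ arm j ι) (sym eq) (at-arm j ι (inject₁ q))))
    ... | refl with armSplit (at-arm i κ (inject₁ p)) (subst (_∈ arm j ι) (sym eq) (at-arm j ι (inject₁ q)))
    ... | refl = cong (mid i κ) (Fin.inject₁-injective (Fin.suc-injective (A.at-inj i κ eq)))

    avoids : ∀ i κ v {w} → w ≡ z i κ ⊎ w ∈ tail (sink i κ) κ → w ≢ goal (sink i κ) → φ v ≢ w
    avoids i κ (s j) (inj₁ refl) _ eq with armApart {κ = κ} {ι = κ} (here (sym eq)) (there (z-arm i κ))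
    ... | refl = s∉arm (subst (_∈ arm i κ) (sym eq) (z-arm i κ))
    avoids i κ (s j) (inj₂ w∈) _ eq = armTail {κ = false} (here (sym eq)) w∈
    avoids i κ (t j) (inj₁ refl) _ eq = armTail (there (z-arm i κ)) (subst (_∈ tail j false) eq (t∈tail j false))
    avoids i κ (t j) (inj₂ w∈) ne eq =
      ne (trans (sym eq) (cong (goal) (tailApart (subst (_∈ tail j false) eq (t∈tail j false)) w∈)))
    avoids i κ (mid j ι p) (inj₁ refl) _ eq
      with armApart (there (z-arm i κ)) (there (subst (_∈ arm j ι) eq (at-arm j ι (inject₁ p))))
    ... | refl with armSplit (z-arm i κ) (subst (_∈ arm j ι) eq (at-arm j ι (inject₁ p)))
    ... | refl = Fin.fromℕ≢inject₁ (sym (Fin.suc-injective (A.at-inj i κ {suc (inject₁ p)} {fromℕ (suc b)} (trans eq (sym (A.final i κ))))))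
    avoids i κ (mid j ι p) (inj₂ w∈) _ eq = armTail (there (subst (_∈ arm j ι) eq (at-arm j ι (inject₁ p)))) w∈

    -- Tails with the same sink and different sides meet only in `goal`, which is not internal; on
    -- one side, `sink` is injective.
    separate : ∀ i κ j ι {w} → w ≡ z i κ ⊎ w ∈ tail (sink i κ) κ → w ≢ goal (sink i κ) →
      w ≡ z j ι ⊎ w ∈ tail (sink j ι) ι → (i , κ) ≡ (j , ι)
    separate i κ j ι (inj₁ refl) _ (inj₁ eq)
      with armApart (there (z-arm i κ)) (there (subst (_∈ arm j ι) (sym eq) (z-arm j ι)))
    ... | refl with armSplit (z-arm i κ) (subst (_∈ arm j ι) (sym eq) (z-arm j ι))
    ... | refl = refl
    separate i κ j ι (inj₁ refl) _ (inj₂ w∈) = ⊥-elim (armTail (there (z-arm i κ)) w∈)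
    separate i κ j ι (inj₂ w∈) _ (inj₁ refl) = ⊥-elim (armTail (there (z-arm j ι)) w∈)
    separate i κ j ι (inj₂ w∈) ne (inj₂ w∈′) = same κ ι w∈ ne w∈′ (tailApart w∈ w∈′)
      where
      same : ∀ κ ι {w} → w ∈ tail (sink i κ) κ → w ≢ goal (sink i κ) → w ∈ tail (sink j ι) ι →
        sink i κ ≡ sink j ι → (i , κ) ≡ (j , ι)
      same false false _ _ _ eq = cong (_, false) (sink-inj i j false eq)
      same true true _ _ _ eq = cong (_, true) (sink-inj i j true eq)
      same false true w∈ ne w∈′ refl = ⊥-elim (ne (tailMeet w∈ w∈′))
      same true false w∈ ne w∈′ refl = ⊥-elim (ne (tailMeet w∈′ w∈))

  subdivision : Subdivision (Cab (suc a) (suc b)) D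
  subdivision = record
    { φ = φ ; φ-inj = λ {u} {v} → φ-inj u v
    ; path = λ { (i , κ , k) → segment i κ (place k) }
    ; avoid = λ { (i , κ , k) v w int → let (_ , w∈ , ne) = segment-internal i κ (place k) int in avoids i κ v w∈ ne }
    ; disj = λ { (i , κ , k) (j , ι , l) w e≢ int int′ →
        let (k≡ , w∈ , ne) = segment-internal i κ (place k) int
            (l≡ , w∈′ , _) = segment-internal j ι (place l) int′
        in e≢ (cong₂ (λ { (x , y) q → x , y , q }) (separate i κ j ι w∈ ne w∈′) (trans k≡ (sym l≡))) } }

-- The construction

avoiding-∉ : ∀ {n} (adj : Fin n → Fin n → Bool) {W u v xs} → Walk (Avoiding adj W) u v xs → u ∉ W → ∀ {x} → x ∈ xs → x ∉ W
avoiding-∉ adj [] u∉ (here refl) = u∉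
avoiding-∉ adj (_ ∷ _) u∉ (here refl) = u∉
avoiding-∉ adj ((_ , _ , v∉) ∷ p) u∉ (there x∈) = avoiding-∉ adj p v∉ x∈

-- The chain has `suc m` spiders with arms of length `b`; the closing spider makes `m + 2` sources.
-- `k` exceeds the number of exits, `w` bounds the set to be avoided, `r₂` and `r₃` are the paths
-- per end of the chain and per arm of the closing spider, `c` and `β` the pruning thresholds, `K₁`
-- the out-degree kept inside the trap, `K₂` the out-degree towards smaller ranks.
record Sizes (m b K k w r₂ r₃ c β K₁ K₂ : ℕ) : Set where
  spiderSize : ℕ
  spiderSize = suc (b + (b + b))
  field
    0<w        : 0 < w
    0<K₂       : 0 < K₂
    degree     : K₁ + k ≤ K
    structure  : suc m * spiderSize + m * (suc b + suc b) + spiderSize ≤ w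
    w≤K₁       : w ≤ K₁
    ports≤K₁   : c + c ≤ K₁
    layers     : K₂ + spiderSize ≤ K₁
    moves      : (c + c) * b ≤ K₂
    dense      : ∀ ℓ u e → 0 < ℓ → u ≤ ℓ * spiderSize → (ℓ * 2) * ((c + c) * (K₂ ∸ (c + c) * b)) ≤ K₂ * e →
                 (c + c + c) * ℓ + β * u < e
    chain-c    : suc m * spiderSize + m ≤ c
    chain-β    : suc m * 4 ≤ β
    quota₂     : 2 * r₂ + w ≤ k
    quota₃     : 3 * r₃ + w ≤ k
    surplus    : k + r₃ ≤ r₂ + 3 * r₃

portArm : Bool → Fin 3
portArm false = zero
portArm true = suc zero

portArm-not : ∀ κ → portArm κ ≢ portArm (not κ)
portArm-not false ()
portArm-not true ()

module Construction (D : Digraph) (0<n : 0 < n D) {m b K k w r₂ r₃ c β K₁ K₂ : ℕ}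
  (sizes : Sizes m b K k w r₂ r₃ c β K₁ K₂) (rich : ∀ v → K ≤ length (outs (adj D) v)) where

  open Sizes sizes

  V : Set
  V = Fin (n D)

  Arc : V → V → Set
  Arc = Adj (adj D)

  open import Data.List.Membership.DecPropositional (Fin._≟_ {n D}) using (_∈?_)

  k≤K : k ≤ K
  k≤K = ≤-trans (m≤n+m k K₁) degree

  opaque
    theTrap : Trap (adj D) k
    theTrap = trap (adj D) (<-≤-trans 0<w (≤-trans (m≤n+m w _) quota₂)) 0<n

  open Trap theTrap

  inOuts : V → List V
  inOuts v = filter In? (outs (adj D) v)

  inOuts-unique : ∀ v → Unique (inOuts v)
  inOuts-unique v = Uniq.filter⁺ _ (outs-unique (adj D) v)

  ∈-inOuts⁻ : ∀ {v x} → x ∈ inOuts v → Arc v x × In x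
  ∈-inOuts⁻ {v} x∈ = let (x∈o , xIn) = ∈-filter⁻ In? {xs = outs (adj D) v} x∈ in ∈-outs⁻ (adj D) x∈o , xIn

  inOuts-rich : ∀ {v} → In v → K₁ ≤ length (inOuts v)
  inOuts-rich {v} v∈ = +-cancelʳ-≤ k _ _ (begin
    K₁ + k ≤⟨ degree ⟩
    K ≤⟨ rich v ⟩
    length (outs (adj D) v) ≡⟨ length-filter-partition In? (outs (adj D) v) ⟨
    length (inOuts v) + length (filter (¬? ∘ In?) (outs (adj D) v))
      ≤⟨ +-monoʳ-≤ (length (inOuts v)) (<⇒≤ (≤-<-trans (unique-⊑⇒length≤ (Uniq.filter⁺ _ (outs-unique (adj D) v)) leave) exits<)) ⟩
    length (inOuts v) + k ∎)
    where
    open ≤-Reasoning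
    leave : filter (¬? ∘ In?) (outs (adj D) v) ⊑ exits
    leave x∈ with ∈-filter⁻ (¬? ∘ In?) {xs = outs (adj D) v} x∈
    ... | x∈o , ¬In = [ (λ p → ⊥-elim (¬In p)) , id ]′ (closed v∈ (∈-outs⁻ (adj D) x∈o))

  opaque
    R : Ranked (adj D) b K₂ In
    R = ranked (adj D) b K₁ K₂ In? inOuts-rich layers

  open Ranked R
  open Packing packing

  module Sp (i : Fin ℓ) = Spider (spiders i)

  port : Fin ℓ × Bool → V
  port (i , κ) = Sp.end i (portArm κ)

  port-In : ∀ p → In (port p)
  port-In (i , κ) = within i (Sp.end∈verts i (portArm κ))

  opaque
    seeds : ∀ p → ∃ λ zs → Unique zs × length zs ≡ c + c × zs ⊑ inOuts (port p) × zs ∥ []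
    seeds p = pickMany Fin._≟_ [] (c + c) (inOuts-unique (port p)) (≤-trans ports≤K₁ (inOuts-rich (port-In p)))

  Γ₀ : Fin ℓ × Bool → List V
  Γ₀ = proj₁ ∘ seeds

  Γ₀-arc : ∀ p {x} → x ∈ Γ₀ p → Arc (port p) x × In x
  Γ₀-arc p x∈ = ∈-inOuts⁻ (proj₁ (proj₂ (proj₂ (proj₂ (seeds p)))) x∈)

  module E = Elimination (adj D) In? R (c + c) 0<K₂ moves

  key< : ∀ {v} → In v → E.key v < n D + b * n D
  key< {v} v∈ = +-mono-<-≤ (Fin.toℕ<n v) (*-monoˡ-≤ (n D) (rank≤ v∈))

  allPorts : List (Fin ℓ × Bool)
  allPorts = cartesianProduct (allFin ℓ) bools

  opaque
    eliminated : ∃ λ e → E.Rooted e (n D + b * n D) × ∃ λ Γ → E.Thin allPorts Γ ×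
      (∀ p {t′} → t′ ∈ Γ p → Covered t′ × ∃ λ x → x ∈ Γ₀ p × e x ≡ t′) ×
      ∑ allPorts (E.weight ∘ Γ₀) ≤ K₂ * ∑ allPorts (length ∘ Γ)
    eliminated = E.eliminate allPorts (b * n D) Γ₀
      (λ p → let (_ , u , len , _) = seeds p in u , ≤-reflexive len)
      (λ p x∈ → let xIn = proj₂ (Γ₀-arc p x∈) in xIn , key< xIn)

  e : V → V
  e = proj₁ eliminated

  Γ : Fin ℓ × Bool → List V
  Γ = proj₁ (proj₂ (proj₂ eliminated))

  Γ-thin : E.Thin allPorts Γ
  Γ-thin = proj₁ (proj₂ (proj₂ (proj₂ eliminated)))

  Γ-from : ∀ p {t′} → t′ ∈ Γ p → Covered t′ × ∃ λ x → x ∈ Γ₀ p × e x ≡ t′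
  Γ-from = proj₁ (proj₂ (proj₂ (proj₂ (proj₂ eliminated))))

  -- `tree` records the common root of all vertices of the walk, which makes branches of different
  -- sinks disjoint.
  record Branch (u t′ : V) : Set where
    constructor branch
    field
      x    : V
      xs   : List V
      arc  : Arc u x
      walk : Walk Arc x t′ xs
      uniq : Unique xs
      bound : length xs ≤ suc b
      tree : ∀ {y} → y ∈ xs → In y × e y ≡ t′

  rootWalk : ∀ {v} → In v → Covered (e v) × ∃ λ xs →
    Walk Arc v (e v) xs × length xs ≤ suc (rank v) × (∀ {x} → x ∈ xs → In x × e x ≡ e v × E.key x < n D + b * n D)
  rootWalk v∈ = proj₁ (proj₂ eliminated) v∈ (key< v∈)

  opaque
    branchTo : ∀ p {t′} → t′ ∈ Γ p → Branch (port p) t′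
    branchTo p t∈ with Γ-from p t∈
    ... | _ , x , x∈ , refl with Γ₀-arc p x∈
    ... | arc , xIn with rootWalk xIn
    ... | _ , xs , q , len , tree with shortcut Fin._≟_ q
    ... | ys , q′ , uq , sub = branch x ys arc q′ uq
      (≤-trans (unique-⊑⇒length≤ uq sub) (≤-trans len (s≤s (rank≤ xIn))))
      λ y∈ → let (yIn , eq , _) = tree (sub y∈) in yIn , eq

  -- Rank zero leaves room for a single vertex on the walk to the root. Hence a vertex of the
  -- packing in the tree of a sink is that sink itself.
  e-covered : ∀ {v} → Covered v → e v ≡ v
  e-covered {v} cv@(i , v∈) with rootWalk (within i v∈)
  ... | _ , xs , q , len , _ = single q (subst (λ r → length xs ≤ suc r) (0rank cv) len)
    where
    single : ∀ {u v xs} → Walk Arc u v xs → length xs ≤ 1 → v ≡ u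
    single [] _ = refl
    single (_ ∷ []) (s≤s ())
    single (_ ∷ (_ ∷ _)) (s≤s ())

  0<ℓ : 0 < ℓ
  0<ℓ = ≤-<-trans z≤n (Fin.toℕ<n (proj₁ (proj₁ (rootWalk (proj₂ inside)))))

  module P = Pruning Γ c β (proj₁ ∘ Γ-thin) (proj₂ ∘ Γ-thin)

  opaque
    pruned : P.Pruned
    pruned = P.prune _ (allFin ℓ) U (Uniq.allFin⁺ ℓ) ≤-refl
      (subst (λ s′ → (c + c + c) * s′ + β * length U < P.edges (allFin ℓ) U) (sym (length-allFin ℓ))
        (dense ℓ (length U) (P.edges (allFin ℓ) U) 0<ℓ few many))
      where
      open ≤-Reasoning
      all : List V
      all = concatMap Sp.verts (allFin ℓ)
      U : List V
      U = filter (_∈? all) (allFin (n D))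
      few : length U ≤ ℓ * spiderSize
      few = begin
        length U ≤⟨ unique-⊑⇒length≤ (Uniq.filter⁺ _ (Uniq.allFin⁺ (n D))) (proj₂ ∘ ∈-filter⁻ (_∈? all) {xs = allFin (n D)}) ⟩
        length all ≤⟨ length-concatMap≤ Sp.verts spiderSize (≤-reflexive ∘ Sp.length-verts) (allFin ℓ) ⟩
        length (allFin ℓ) * spiderSize ≡⟨ cong (_* spiderSize) (length-allFin ℓ) ⟩
        ℓ * spiderSize ∎
      -- All roots lie in the packing, so restricting to `U` discards no edge.
      U-all : ∀ p → filter (_∈? U) (Γ p) ≡ Γ p
      U-all p = filter-all (_∈? U) (All.tabulate λ {x} x∈ → let (i , x∈i) = proj₁ (Γ-from p x∈) in
        ∈-filter⁺ (_∈? all) (∈-allFin x) (∈-concatMap⁺ Sp.verts {xs = allFin ℓ} (lose (∈-allFin i) x∈i)))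
      many : (ℓ * 2) * ((c + c) * (K₂ ∸ (c + c) * b)) ≤ K₂ * P.edges (allFin ℓ) U
      many = begin
        (ℓ * 2) * W₀ ≡⟨ cong (λ l → (l * 2) * W₀) (length-allFin ℓ) ⟨
        (length (allFin ℓ) * 2) * W₀ ≡⟨ cong (_* W₀) (length-×bools (allFin ℓ)) ⟨
        length allPorts * W₀ ≡⟨ ∑-const allPorts W₀ ⟨
        ∑ allPorts (λ _ → W₀) ≤⟨ ∑-mono allPorts (λ {p} _ → heavy p) ⟩
        ∑ allPorts (E.weight ∘ Γ₀) ≤⟨ proj₂ (proj₂ (proj₂ (proj₂ (proj₂ eliminated)))) ⟩
        K₂ * ∑ allPorts (length ∘ Γ) ≤⟨ *-monoʳ-≤ K₂ (∑-mono allPorts (λ {p} _ → ≤-reflexive (cong length (sym (U-all p))))) ⟩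
        K₂ * P.edges (allFin ℓ) U ∎
        where
        W₀ : ℕ
        W₀ = (c + c) * (K₂ ∸ (c + c) * b)
        heavy : ∀ p → W₀ ≤ E.weight (Γ₀ p)
        heavy p = begin
          (c + c) * (K₂ ∸ (c + c) * b) ≡⟨ cong (_* (K₂ ∸ (c + c) * b)) (proj₁ (proj₂ (proj₂ (seeds p)))) ⟨
          length (Γ₀ p) * (K₂ ∸ (c + c) * b) ≡⟨ ∑-const (Γ₀ p) _ ⟨
          ∑ (Γ₀ p) (λ _ → K₂ ∸ (c + c) * b) ≤⟨ ∑-mono (Γ₀ p) (λ x∈ → ∸-monoʳ-≤ K₂ (*-monoʳ-≤ (c + c) (rank≤ (proj₂ (Γ₀-arc p x∈))))) ⟩
          E.weight (Γ₀ p) ∎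

  module Ch = P.Chains pruned Sp.verts spiderSize Sp.length-verts apart

  opaque
    theChain : Ch.Chain m
    theChain = Ch.chain m chain-c chain-β

  open Ch.Chain theChain

  -- Two branches in one tree may merge before reaching its root. Their meeting vertex `g` takes the
  -- place of the sink in the subdivision.
  record Meeting (u u′ t′ : V) : Set where
    field
      g x x′   : V
      xs xs′   : List V
      arc      : Arc u x
      arc′     : Arc u′ x′
      walk     : Walk Arc x g xs
      walk′    : Walk Arc x′ g xs′
      uniq     : Unique xs
      uniq′    : Unique xs′
      size     : length (xs ++ xs′) ≤ suc b + suc b
      tree     : ∀ {y} → y ∈ xs ++ xs′ → e y ≡ t′
      meet     : ∀ {y} → y ∈ xs → y ∈ xs′ → y ≡ g

  opaque
    meeting : ∀ {u u′ t′} → Branch u t′ → Branch u′ t′ → Meeting u u′ t′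
    meeting {t′ = t′} B B′ = record
      { g = C.mid ; x = B.x ; x′ = B′.x ; xs = C.pre ; xs′ = C′.pre ; arc = B.arc ; arc′ = B′.arc ; walk = C.before ; walk′ = upTo cut′
      ; uniq = C.pre-unique B.uniq ; uniq′ = C′.pre-unique B′.uniq
      ; size = ≤-trans (≤-reflexive (length-++ C.pre)) (+-mono-≤
          (≤-trans (unique-⊑⇒length≤ (C.pre-unique B.uniq) C.pre⊑) B.bound)
          (≤-trans (unique-⊑⇒length≤ (C′.pre-unique B′.uniq) C′.pre⊑) B′.bound))
      ; tree = λ y∈ → [ proj₂ ∘ B.tree ∘ C.pre⊑ , proj₂ ∘ B′.tree ∘ C′.pre⊑ ]′ (∈-++⁻ C.pre y∈)
      ; meet = λ y∈ y∈′ → C.only y∈ (C′.pre⊑ y∈′) }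
      where
      module B = Branch B
      module B′ = Branch B′
      cut : Cut {E = Arc} B.x t′ B.xs (_∈ B′.xs)
      cut = firstHit (_∈? B′.xs) B.walk (t′ , walk-dst B.walk , walk-dst B′.walk)
      module C = Cut cut
      cut′ : Cut {E = Arc} B′.x t′ B′.xs (_≡ C.mid)
      cut′ = splitAt∈ Fin._≟_ B′.walk C.hit
      module C′ = Cut cut′

  -- `after` comes first because, in the frame, the `false` tail at this sink continues the later
  -- spider and the `true` tail its predecessor.
  module Mt (j : Fin m) = Meeting (meeting (branchTo _ (after j)) (branchTo _ (before j)))

  chainVerts : List V
  chainVerts = concatMap (Sp.verts ∘ lam) (allFin (suc m)) ++ concatMap (λ j → Mt.xs j ++ Mt.xs′ j) (allFin m)

  lam-chain : ∀ i {v} → v ∈ Sp.verts (lam i) → v ∈ chainVerts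
  lam-chain i v∈ = ∈-++⁺ˡ (∈-concatMap⁺ (Sp.verts ∘ lam) {xs = allFin (suc m)} (lose (∈-allFin i) v∈))

  Mt-chain : ∀ j {v} → v ∈ Mt.xs j ++ Mt.xs′ j → v ∈ chainVerts
  Mt-chain j v∈ = ∈-++⁺ʳ (concatMap (Sp.verts ∘ lam) (allFin (suc m)))
    (∈-concatMap⁺ (λ j → Mt.xs j ++ Mt.xs′ j) {xs = allFin m} (lose (∈-allFin j) v∈))

  chainVerts-size : length chainVerts + spiderSize ≤ w
  chainVerts-size = ≤-trans (+-monoˡ-≤ spiderSize (≤-trans (≤-reflexive (length-++ (concatMap (Sp.verts ∘ lam) (allFin (suc m)))))
      (+-mono-≤
        (≤-trans (length-concatMap≤ (Sp.verts ∘ lam) spiderSize (λ i → ≤-reflexive (Sp.length-verts (lam i))) (allFin (suc m)))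
                 (≤-reflexive (cong (_* spiderSize) (length-allFin (suc m)))))
        (≤-trans (length-concatMap≤ (λ j → Mt.xs j ++ Mt.xs′ j) (suc b + suc b) Mt.size (allFin m))
                 (≤-reflexive (cong (_* (suc b + suc b)) (length-allFin m)))))))
    structure

  opaque
    -- Its centre is the last of the a sources.
    extra : ∃ λ (X : Spider (adj D) b) → (Spider.verts X ∥ chainVerts) × (∀ {v} → v ∈ Spider.verts X → In v)
    extra with pick Fin._≟_ {ys = chainVerts} (inOuts-unique (proj₁ inside))
      (<-≤-trans (≤-trans (≤-trans (≤-reflexive (+-comm 1 _)) (+-monoʳ-≤ (length chainVerts) (s≤s z≤n))) (≤-trans chainVerts-size w≤K₁)) (inOuts-rich (proj₂ inside)))
    ... | x , x∈ , x∉ with Greedy.spider (adj D) (λ _ → In) K₁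
          (λ _ v v∈ → inOuts v , inOuts-unique v , inOuts-rich v∈ , ∈-inOuts⁻) In id
          b x chainVerts (proj₂ (∈-inOuts⁻ x∈)) x∉ (≤-trans chainVerts-size w≤K₁)
    ... | X , _ , avoid , region = X , avoid , region

  X : Spider (adj D) b
  X = proj₁ extra

  module X = Spider X

  -- Linking the chain and the closing spider to the exits

  W : List V
  W = X.verts ++ chainVerts

  W-size : length W ≤ w
  W-size = ≤-trans (≤-reflexive (trans (length-++ X.verts) (trans (cong (_+ length chainVerts) X.length-verts) (+-comm spiderSize _)))) chainVerts-size

  -- The colour of a path names the arm end with an arc to its start. A start may itself be an exit,
  -- which allows paths of a single vertex.
  record Legs (C : ℕ) (z : Fin C → V) (r : ℕ) : Set where
    field
      Z       : List V
      size    : length Z ≡ C * r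
      linkage : Menger.Linkage (Avoiding (adj D) W) Z exits (length Z)
    open Menger.Linkage linkage public
    field
      col     : Fin (length Z) → Fin C
      arc     : ∀ i → Arc (z (col i)) (src i)
      quota   : ∀ κ → length (filter (λ i → col i Fin.≟ κ) (allFin (length Z))) ≤ r
      outside : ∀ i {v} → v ∈ vs i → v ∉ W

    dst-inj : ∀ {i j} → dst i ≡ dst j → i ≡ j
    dst-inj {i} {j} eq = Menger.Linkage.apart linkage (walk-dst (walk i)) (subst (_∈ vs j) (sym eq) (walk-dst (walk j)))

    dsts : List V
    dsts = map dst (allFin (length Z))

    dsts-unique : Unique dsts
    dsts-unique = unique-map (Uniq.allFin⁺ _) (λ _ _ → dst-inj)

  opaque
    starts : ∀ C (z : Fin C → V) r ys → length ys + C * r ≤ K →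
      ∃ λ Z → Unique Z × length Z ≡ C * r × Z ∥ ys ×
      ∃ λ (Zs : Fin C → List V) → (∀ κ → length (Zs κ) ≡ r × Zs κ ⊑ outs (adj D) (z κ)) × (∀ {v} → v ∈ Z → ∃ λ κ → v ∈ Zs κ)
    starts zero z r ys le = [] , [] , refl , (λ ()) , (λ ()) , (λ ()) , λ ()
    starts (suc C) z r ys le
      with pickMany Fin._≟_ ys r (outs-unique (adj D) (z zero)) (≤-trans (+-monoʳ-≤ (length ys) (m≤m+n r (C * r))) (≤-trans le (rich (z zero))))
    ... | Z₀ , u₀ , len₀ , sub₀ , dis₀
      with starts C (z ∘ suc) r (Z₀ ++ ys) (≤-trans (≤-reflexive (trans (cong (_+ C * r) (trans (length-++ Z₀) (trans (cong (_+ length ys) len₀) (+-comm r _)))) (+-assoc (length ys) r (C * r)))) le)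
    ... | Z , u , len , dis , Zs , good , cover =
        Z₀ ++ Z , Uniq.++⁺ u₀ u (λ (p , q) → dis q (∈-++⁺ˡ p)) , trans (length-++ Z₀) (cong₂ _+_ len₀ len)
      , (λ p q → [ (λ p → dis₀ p q) , (λ p → dis p (∈-++⁺ʳ Z₀ q)) ]′ (∈-++⁻ Z₀ p))
      , (λ { zero → Z₀ ; (suc κ) → Zs κ })
      , (λ { zero → len₀ , sub₀ ; (suc κ) → good κ })
      , (λ p → [ (λ p → zero , p) , (λ p → let (κ , q) = cover p in suc κ , q) ]′ (∈-++⁻ Z₀ p))

    paint : ∀ C (z : Fin C → V) r {Z} → length Z ≡ C * r → Z ∥ W → (Zs : Fin C → List V) →
      (∀ κ → length (Zs κ) ≡ r × Zs κ ⊑ outs (adj D) (z κ)) → (∀ {v} → v ∈ Z → ∃ λ κ → v ∈ Zs κ) →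
      Menger.Linkage (Avoiding (adj D) W) Z exits (length Z) → Legs C z r
    paint C z r {Z} size dis Zs good cover L = record
      { Z = Z ; size = size ; linkage = L ; col = col
      ; arc = λ i → ∈-outs⁻ (adj D) (proj₂ (good (col i)) (proj₂ (cover (L.src∈ i))))
      ; quota = quota ; outside = λ i → avoiding-∉ (adj D) (L.walk i) (dis (L.src∈ i)) }
      where
      module L = Menger.Linkage L
      col : Fin (length Z) → Fin C
      col i = proj₁ (cover (L.src∈ i))
      quota : ∀ κ → length (filter (λ i → col i Fin.≟ κ) (allFin (length Z))) ≤ r
      quota κ = ≤-trans (≤-reflexive (sym (length-map L.src is))) (≤-trans
          (unique-⊑⇒length≤ (unique-map (Uniq.filter⁺ _ (Uniq.allFin⁺ _)) (λ {i} {j} _ _ eq →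
              L.apart (walk-src (L.walk i)) (subst (_∈ L.vs j) (sym eq) (walk-src (L.walk j))))) sub)
          (≤-reflexive (proj₁ (good κ))))
        where
        is : List (Fin (length Z))
        is = filter (λ i → col i Fin.≟ κ) (allFin (length Z))
        sub : map L.src is ⊑ Zs κ
        sub v∈ with ∈-map⁻ L.src v∈
        ... | i , i∈ , refl = subst (λ x → L.src i ∈ Zs x) (proj₂ (∈-filter⁻ (λ i → col i Fin.≟ κ) {xs = allFin (length Z)} i∈))
                                (proj₂ (cover (L.src∈ i)))

    legs : ∀ C (z : Fin C → V) r → (∀ κ → In (z κ)) → C * r + w ≤ k → Legs C z r
    legs C z r zIn le with starts C z r W (≤-trans (≤-trans (≤-reflexive (+-comm (length W) _)) (+-monoʳ-≤ (C * r) W-size)) (≤-trans le k≤K))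
    ... | Z , u , size , dis , Zs , good , cover = paint C z r size dis Zs good cover
      (linkToExits (adj D) theTrap W Z {X.centre} (here refl) (proj₂ (proj₂ extra) (here refl)) u dis
        (λ z∈ → let (κ , q) = cover z∈ in closed (zIn κ) (∈-outs⁻ (adj D) (proj₂ (good κ) q)))
        (≤-trans (+-mono-≤ (≤-reflexive size) W-size) le))

  zL : Fin 2 → V
  zL zero = port (lam zero , o zero)
  zL (suc zero) = port (lam (fromℕ m) , not (o (fromℕ m)))

  opaque
    L : Legs 2 zL r₂
    L = legs 2 zL r₂ (λ { zero → port-In _ ; (suc zero) → port-In _ }) quota₂

    M : Legs 3 X.end r₃
    M = legs 3 X.end r₃ (λ κ → proj₂ (proj₂ extra) (X.end∈verts κ)) quota₃

  module L = Legs L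
  module M = Legs M

  otherColour : ∀ (x y z : Fin 2) → x ≢ y → z ≢ x → z ≡ y
  otherColour zero zero _ x≢y _ = ⊥-elim (x≢y refl)
  otherColour (suc zero) (suc zero) _ x≢y _ = ⊥-elim (x≢y refl)
  otherColour zero (suc zero) zero _ z≢x = ⊥-elim (z≢x refl)
  otherColour zero (suc zero) (suc zero) _ _ = refl
  otherColour (suc zero) zero zero _ _ = refl
  otherColour (suc zero) zero (suc zero) _ z≢x = ⊥-elim (z≢x refl)

  -- Fewer than k exits hold the ends of 3 r₃ paths of M, so most of the r₂ paths of L of a given
  -- colour end where a path of M ends.
  ends : ∀ {x y} → x ≢ y → ∀ κ → ∃ λ i → L.col i ≡ x × ∃ λ j → M.col j ≢ κ × L.dst i ∈ M.vs j
  ends {x} {y} x≢y κ with pick Fin._≟_ {ys = badEnds} (Uniq.filter⁺ (_∈? M.dsts) ends-unique) enough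
    where
    is : List (Fin (length L.Z))
    is = filter (λ i → L.col i Fin.≟ x) (allFin (length L.Z))
    xs : List V
    xs = map L.dst is
    js : List (Fin (length M.Z))
    js = filter (λ j → M.col j Fin.≟ κ) (allFin (length M.Z))
    badEnds : List V
    badEnds = map M.dst js
    ends-unique : Unique xs
    ends-unique = unique-map (Uniq.filter⁺ _ (Uniq.allFin⁺ _)) (λ _ _ → L.dst-inj)
    open ≤-Reasoning
    many : r₂ ≤ length xs
    many = +-cancelʳ-≤ r₂ _ _ (begin
      r₂ + r₂ ≡⟨ cong (r₂ +_) (+-identityʳ r₂) ⟨
      2 * r₂ ≡⟨ L.size ⟨
      length L.Z ≡⟨ length-allFin (length L.Z) ⟨
      length (allFin (length L.Z)) ≡⟨ length-filter-partition (λ i → L.col i Fin.≟ x) (allFin (length L.Z)) ⟨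
      length is + length (filter (λ i → ¬? (L.col i Fin.≟ x)) (allFin (length L.Z)))
        ≤⟨ +-mono-≤ (≤-reflexive (sym (length-map L.dst is))) (≤-trans (unique-⊑⇒length≤ (Uniq.filter⁺ _ (Uniq.allFin⁺ _)) others) (L.quota y)) ⟩
      length xs + r₂ ∎)
      where
      others : filter (λ i → ¬? (L.col i Fin.≟ x)) (allFin (length L.Z)) ⊑ filter (λ i → L.col i Fin.≟ y) (allFin (length L.Z))
      others i∈ with ∈-filter⁻ (λ i → ¬? (L.col i Fin.≟ x)) {xs = allFin (length L.Z)} i∈
      ... | i∈′ , ne = ∈-filter⁺ (λ i → L.col i Fin.≟ y) i∈′ (otherColour x y _ x≢y ne)
    O I : ℕ
    O = length (filter (λ v → ¬? (v ∈? M.dsts)) xs)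
    I = length (filter (_∈? M.dsts) xs)
    missed : O + 3 * r₃ < k
    missed = begin-strict
      O + 3 * r₃ ≡⟨ +-comm O _ ⟩
      3 * r₃ + O ≡⟨ cong (_+ O) (trans (sym M.size) (sym (trans (length-map M.dst (allFin (length M.Z))) (length-allFin (length M.Z))))) ⟩
      length M.dsts + O ≡⟨ length-++ M.dsts ⟨
      length (M.dsts ++ filter (λ v → ¬? (v ∈? M.dsts)) xs)
        ≤⟨ unique-⊑⇒length≤ (Uniq.++⁺ M.dsts-unique (Uniq.filter⁺ _ ends-unique)
             (λ (p , q) → proj₂ (∈-filter⁻ (λ v → ¬? (v ∈? M.dsts)) {xs = xs} q) p)) inExits ⟩
      length exits <⟨ exits< ⟩
      k ∎
      where
      inExits : (M.dsts ++ filter (λ v → ¬? (v ∈? M.dsts)) xs) ⊑ exits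
      inExits v∈ with ∈-++⁻ M.dsts v∈
      ... | inj₁ p with ∈-map⁻ M.dst p
      ... | j , _ , refl = M.dst∈ j
      inExits v∈ | inj₂ p with ∈-map⁻ L.dst (proj₁ (∈-filter⁻ (λ v → ¬? (v ∈? M.dsts)) {xs = xs} p))
      ... | i , _ , refl = L.dst∈ i
    -- By `missed` and `surplus`, more than `r₃` ends of colour `x` are also ends of `M`, and at
    -- most `r₃` ends of `M` have colour `κ`.
    enough : length badEnds < I
    enough = ≤-<-trans (≤-trans (≤-reflexive (length-map M.dst js)) (M.quota κ)) (+-cancelˡ-< k _ _ (begin-strict
      k + r₃ ≤⟨ surplus ⟩
      r₂ + 3 * r₃ ≤⟨ +-monoˡ-≤ (3 * r₃) many ⟩
      length xs + 3 * r₃ ≡⟨ cong (_+ 3 * r₃) (length-filter-partition (_∈? M.dsts) xs) ⟨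
      I + O + 3 * r₃ ≡⟨ +-assoc I O _ ⟩
      I + (O + 3 * r₃) <⟨ +-monoʳ-< I missed ⟩
      I + k ≡⟨ +-comm I k ⟩
      k + I ∎))
  ... | v , v∈ , v∉ with ∈-filter⁻ (_∈? M.dsts) {xs = map L.dst (filter (λ i → L.col i Fin.≟ x) (allFin (length L.Z)))} v∈
  ... | v∈L , v∈M with ∈-map⁻ L.dst v∈L | ∈-map⁻ M.dst v∈M
  ... | i , i∈ , refl | j , j∈ , eq = i , proj₂ (∈-filter⁻ (λ i → L.col i Fin.≟ x) {xs = allFin (length L.Z)} i∈) , j
      , (λ col → v∉ (subst (_∈ map M.dst (filter (λ j → M.col j Fin.≟ κ) (allFin (length M.Z)))) (sym eq)
          (∈-map⁺ M.dst (∈-filter⁺ (λ j → M.col j Fin.≟ κ) j∈ col))))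
      , subst (_∈ M.vs j) (sym eq) (walk-dst (M.walk j))

  module Jn = Joining (Fin._≟_ {n D}) {E = Avoiding (adj D) W} (Fin._≟_ {3})
    L.src L.dst L.vs L.walk L.apart L.col M.src M.dst M.vs M.walk L.unique M.unique M.apart M.col

  opaque
    joins : Jn.TwoJoins zero (suc zero)
    joins = Jn.twoJoins (λ ()) zero (ends {zero} {suc zero} (λ ())) (ends {suc zero} {zero} (λ ()))

  open Jn.TwoJoins joins using (colJ; colJ′; col≢; cross; cross′)
  module G = Jn.Join (Jn.TwoJoins.G joins)
  module G′ = Jn.Join (Jn.TwoJoins.G′ joins)

  -- Assembling the frame

  spiderAt : Fin (suc (suc m)) → Spider (adj D) b
  spiderAt zero = X
  spiderAt (suc i) = spiders (lam i)

  armAt : Fin (suc (suc m)) → Bool → Fin 3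
  armAt zero false = M.col G′.j
  armAt zero true = M.col G.j
  armAt (suc i) false = portArm (o i)
  armAt (suc i) true = portArm (not (o i))

  -- In cyclic order the closing spider comes first and the chain follows. Sink zero lies between
  -- the last spider of the chain and the closing one, sink one between the closing spider and the
  -- first of the chain, both from `joins`; the other sinks are the meetings inside the chain.
  goal f₀ f₁ : Fin (suc (suc m)) → V
  tail₀ tail₁ : Fin (suc (suc m)) → List V
  goal zero = G′.v
  goal (suc zero) = G.v
  goal (suc (suc j)) = Mt.g j
  f₀ zero = M.src G′.j
  f₀ (suc zero) = L.src G.i
  f₀ (suc (suc j)) = Mt.x j
  f₁ zero = L.src G′.i
  f₁ (suc zero) = M.src G.j
  f₁ (suc (suc j)) = Mt.x′ j
  tail₀ zero = G′.ys
  tail₀ (suc zero) = G.xs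
  tail₀ (suc (suc j)) = Mt.xs j
  tail₁ zero = G′.xs
  tail₁ (suc zero) = G.ys
  tail₁ (suc (suc j)) = Mt.xs′ j

  sides : ∀ {A : Set} → (Fin (suc (suc m)) → A) → (Fin (suc (suc m)) → A) → Fin (suc (suc m)) → Bool → A
  sides x y c false = x c
  sides x y c true = y c
  
  frame : Frame D (suc m) b
  frame = record
    { hub = λ i → Spider.centre (spiderAt i)
    ; arm = λ i κ → Spider.arm (spiderAt i) (armAt i κ)
    ; z = λ i κ → Spider.end (spiderAt i) (armAt i κ)
    ; armWalk = λ i κ → Spider.walk (spiderAt i) (armAt i κ)
    ; armUnique = λ i κ → Spider.unique (spiderAt i) (armAt i κ)
    ; armLength = λ i κ → Spider.len (spiderAt i) (armAt i κ)
    ; armApart = λ {i} {j} {κ} {ι} v∈ v∈′ → vertsApart i j (leg i κ v∈) (leg j ι v∈′)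
    ; armSplit = λ {i} {κ} {ι} v∈ v∈′ → armAt-inj i κ ι (Spider.apart (spiderAt i) v∈ v∈′)
    ; goal = goal
    ; f = sides f₀ f₁
    ; tail = sides tail₀ tail₁
    ; tailWalk = λ { c false → walk₀ c ; c true → walk₁ c }
    ; tailUnique = λ { c false → unique₀ c ; c true → unique₁ c }
    ; linkˡ = link₀
    ; linkʳ = link₁
    ; armTail = λ {i} {κ} {c} {ι} v∈ v∈′ → vertsTail i c ι (leg i κ v∈) v∈′
    ; tailApart = λ {c} {c′} {κ} {ι} → tailApart c c′ κ ι
    ; tailMeet = λ {c} → tailMeet c }
    where
    leg : ∀ i κ {v} → v ∈ Spider.centre (spiderAt i) ∷ Spider.arm (spiderAt i) (armAt i κ) → v ∈ Spider.verts (spiderAt i)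
    leg i κ = Spider.leg⊑verts (spiderAt i) (armAt i κ)
    vertsApart : ∀ i j {v} → v ∈ Spider.verts (spiderAt i) → v ∈ Spider.verts (spiderAt j) → i ≡ j
    vertsApart zero zero _ _ = refl
    vertsApart zero (suc j) p q = ⊥-elim (proj₁ (proj₂ extra) p (lam-chain j q))
    vertsApart (suc i) zero p q = ⊥-elim (proj₁ (proj₂ extra) q (lam-chain i p))
    vertsApart (suc i) (suc j) p q = cong suc (lam-inj (apart p q))
    armAt-inj : ∀ i κ ι → armAt i κ ≡ armAt i ι → κ ≡ ι
    armAt-inj i false false _ = refl
    armAt-inj i true true _ = refl
    armAt-inj zero false true eq = ⊥-elim (col≢ (sym eq))
    armAt-inj zero true false eq = ⊥-elim (col≢ eq)
    armAt-inj (suc i) false true eq = ⊥-elim (portArm-not (o i) eq)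
    armAt-inj (suc i) true false eq = ⊥-elim (portArm-not (o i) (sym eq))
    plain : ∀ {u v xs} → Walk (Avoiding (adj D) W) u v xs → Walk Arc u v xs
    plain p = walk-map p (λ _ _ → proj₁)
    walk₀ : ∀ c → Walk Arc (f₀ c) (goal c) (tail₀ c)
    walk₀ zero = plain G′.q
    walk₀ (suc zero) = plain G.p
    walk₀ (suc (suc j)) = Mt.walk j
    walk₁ : ∀ c → Walk Arc (f₁ c) (goal c) (tail₁ c)
    walk₁ zero = plain G′.p
    walk₁ (suc zero) = plain G.q
    walk₁ (suc (suc j)) = Mt.walk′ j
    unique₀ : ∀ c → Unique (tail₀ c)
    unique₀ zero = G′.uq
    unique₀ (suc zero) = G.up
    unique₀ (suc (suc j)) = Mt.uniq j
    unique₁ : ∀ c → Unique (tail₁ c)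
    unique₁ zero = G′.up
    unique₁ (suc zero) = G.uq
    unique₁ (suc (suc j)) = Mt.uniq′ j
    link₀ : ∀ c → Arc (Spider.end (spiderAt c) (armAt c false)) (f₀ c)
    link₀ zero = M.arc G′.j
    link₀ (suc zero) = subst (λ x → Arc (zL x) (L.src G.i)) colJ (L.arc G.i)
    link₀ (suc (suc j)) = Mt.arc j
    link₁ : ∀ c → Arc (Spider.end (spiderAt (prev c)) (armAt (prev c) true)) (f₁ c)
    link₁ zero = subst (λ x → Arc (zL x) (L.src G′.i)) colJ′ (L.arc G′.i)
    link₁ (suc zero) = M.arc G.j
    link₁ (suc (suc j)) = Mt.arc′ j
    inW : ∀ i {v} → v ∈ Spider.verts (spiderAt i) → v ∈ W
    inW zero v∈ = ∈-++⁺ˡ v∈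
    inW (suc i) v∈ = ∈-++⁺ʳ X.verts (lam-chain i v∈)
    Tails : Fin (suc (suc m)) → V → Set
    Tails c v = v ∈ tail₀ c ⊎ v ∈ tail₁ c
    toTails : ∀ c κ {v} → v ∈ sides tail₀ tail₁ c κ → Tails c v
    toTails c false = inj₁
    toTails c true = inj₂
    closing∉ : ∀ {v} → Tails zero v ⊎ Tails (suc zero) v → v ∉ W
    closing∉ (inj₁ (inj₁ p)) = M.outside _ (G′.ys⊑ p)
    closing∉ (inj₁ (inj₂ p)) = L.outside _ (G′.xs⊑ p)
    closing∉ (inj₂ (inj₁ p)) = L.outside _ (G.xs⊑ p)
    closing∉ (inj₂ (inj₂ p)) = M.outside _ (G.ys⊑ p)
    both : ∀ j {v} → Tails (suc (suc j)) v → v ∈ Mt.xs j ++ Mt.xs′ j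
    both j (inj₁ p) = ∈-++⁺ˡ p
    both j (inj₂ p) = ∈-++⁺ʳ (Mt.xs j) p
    treeW : ∀ j {v} → Tails (suc (suc j)) v → v ∈ W
    treeW j p = ∈-++⁺ʳ X.verts (Mt-chain j (both j p))
    vertsTail : ∀ i c κ {v} → v ∈ Spider.verts (spiderAt i) → v ∈ sides tail₀ tail₁ c κ → ⊥
    vertsTail i zero κ p q = closing∉ (inj₁ (toTails zero κ q)) (inW i p)
    vertsTail i (suc zero) κ p q = closing∉ (inj₂ (toTails (suc zero) κ q)) (inW i p)
    vertsTail zero (suc (suc j)) κ p q = proj₁ (proj₂ extra) p (Mt-chain j (both j (toTails (suc (suc j)) κ q)))
    -- A spider vertex in the tree of `τ j` is its own root, hence `τ j` itself, which `clear` keeps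
    -- off the spiders of the chain.
    vertsTail (suc i) (suc (suc j)) κ p q = clear j i (subst (_∈ Sp.verts (lam i))
      (trans (sym (e-covered (lam i , p))) (Mt.tree j (both j (toTails (suc (suc j)) κ q)))) p)
    L≢ : ∀ {v} → v ∈ G′.xs → v ∈ G.xs → ⊥
    L≢ p q with trans (sym colJ′) (trans (cong L.col (L.apart (G′.xs⊑ p) (G.xs⊑ q))) colJ)
    ... | ()
    M≢ : ∀ {v} → v ∈ G′.ys → v ∈ G.ys → ⊥
    M≢ p q = col≢ (cong M.col (M.apart (G.ys⊑ q) (G′.ys⊑ p)))
    closing : ∀ {v} → Tails zero v → Tails (suc zero) v → ⊥
    closing (inj₁ p) (inj₁ q) = cross q p
    closing (inj₁ p) (inj₂ q) = M≢ p q
    closing (inj₂ p) (inj₁ q) = L≢ p q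
    closing (inj₂ p) (inj₂ q) = cross′ p q
    apartTails : ∀ c c′ {v} → Tails c v → Tails c′ v → c ≡ c′
    apartTails zero zero _ _ = refl
    apartTails zero (suc zero) p q = ⊥-elim (closing p q)
    apartTails zero (suc (suc j)) p q = ⊥-elim (closing∉ (inj₁ p) (treeW j q))
    apartTails (suc zero) zero p q = ⊥-elim (closing q p)
    apartTails (suc zero) (suc zero) _ _ = refl
    apartTails (suc zero) (suc (suc j)) p q = ⊥-elim (closing∉ (inj₂ p) (treeW j q))
    apartTails (suc (suc i)) zero p q = ⊥-elim (closing∉ (inj₁ q) (treeW i p))
    apartTails (suc (suc i)) (suc zero) p q = ⊥-elim (closing∉ (inj₂ q) (treeW i p))
    apartTails (suc (suc i)) (suc (suc j)) p q =
      cong (λ x → suc (suc x)) (τ-inj (trans (sym (Mt.tree i (both i p))) (Mt.tree j (both j q))))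
    tailApart : ∀ c c′ κ ι {v} → v ∈ sides tail₀ tail₁ c κ → v ∈ sides tail₀ tail₁ c′ ι → c ≡ c′
    tailApart c c′ κ ι p q = apartTails c c′ (toTails c κ p) (toTails c′ ι q)
    tailMeet : ∀ c {v} → v ∈ tail₀ c → v ∈ tail₁ c → v ≡ goal c
    tailMeet zero p q = G′.meet q p
    tailMeet (suc zero) p q = G.meet p q
    tailMeet (suc (suc j)) p q = Mt.meet j p q

-- `w = 8 * q` covers the chain, its tails and the closing spider. Then `k = 7 * w`, with `r₂` and
-- `r₃` a half and a third of `k - w`, turns `quota₂`, `quota₃` and `surplus` into equalities. `K₂`
-- is eight times the largest drop `(c + c) * suc b` of the weight of a vertex, and `K₁` exceeds it
-- by `w`.
sizes : ∀ m b → let a = suc (suc m) ; q = a * suc b in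
  Sizes m (suc b) (600 * a * suc b ^ 7) (56 * q) (8 * q) (24 * q) (16 * q) (33 * q) (4 * a)
        (8 * ((33 * q + 33 * q) * suc b) + 8 * q) (8 * ((33 * q + 33 * q) * suc b))
sizes m b = record
  { 0<w = s≤s z≤n
  ; 0<K₂ = 0<K₂
  ; degree = degree
  ; structure = ≤-trans (m≤m+n _ (3 * m * b + 10 * b + 8)) (≤-reflexive (structure≡ m b))
  ; w≤K₁ = m≤n+m (8 * q) K₂
  ; ports≤K₁ = ≤-trans (m≤m*n (c + c) (suc b)) (≤-trans (m≤m+n _ _) (m≤m+n K₂ (8 * q)))
  ; layers = +-monoʳ-≤ K₂ (≤-trans (m≤m+n _ (8 * m * b + 8 * m + 13 * b + 12)) (≤-reflexive (spider≡ m b)))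
  ; moves = m≤m+n _ _
  ; dense = dense
  ; chain-c = ≤-trans (m≤m+n _ (30 * m * b + 28 * m + 63 * b + 62)) (≤-reflexive (chain≡ m b))
  ; chain-β = ≤-trans (m≤m+n _ 4) (≤-reflexive (β≡ m))
  ; quota₂ = ≤-reflexive (quota₂≡ q)
  ; quota₃ = ≤-reflexive (quota₃≡ q)
  ; surplus = ≤-reflexive (surplus≡ q)
  }
  where
  a q c K₂ : ℕ
  a = suc (suc m)
  q = a * suc b
  c = 33 * q
  K₂ = 8 * ((c + c) * suc b)
  0<K₂ : 0 < K₂
  0<K₂ = s≤s z≤n
  structure≡ : ∀ m b → (suc m * suc (suc b + (suc b + suc b)) + m * (suc (suc b) + suc (suc b)) + suc (suc b + (suc b + suc b)))
    + (3 * m * b + 10 * b + 8) ≡ 8 * (suc (suc m) * suc b)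
  structure≡ = solve-∀
  spider≡ : ∀ m b → suc (suc b + (suc b + suc b)) + (8 * m * b + 8 * m + 13 * b + 12) ≡ 8 * (suc (suc m) * suc b)
  spider≡ = solve-∀
  chain≡ : ∀ m b → (suc m * suc (suc b + (suc b + suc b)) + m) + (30 * m * b + 28 * m + 63 * b + 62) ≡ 33 * (suc (suc m) * suc b)
  chain≡ = solve-∀
  β≡ : ∀ m → suc m * 4 + 4 ≡ 4 * suc (suc m)
  β≡ = solve-∀
  quota₂≡ : ∀ q → 2 * (24 * q) + 8 * q ≡ 56 * q
  quota₂≡ = solve-∀
  quota₃≡ : ∀ q → 3 * (16 * q) + 8 * q ≡ 56 * q
  quota₃≡ = solve-∀
  surplus≡ : ∀ q → 56 * q + 16 * q ≡ 24 * q + 3 * (16 * q)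
  surplus≡ = solve-∀

  degree : K₂ + 8 * q + 56 * q ≤ 600 * a * suc b ^ 7
  degree = begin
    K₂ + 8 * q + 56 * q ≡⟨ +-assoc K₂ (8 * q) (56 * q) ⟩
    K₂ + (8 * q + 56 * q) ≤⟨ +-monoʳ-≤ K₂ (+-mono-≤ (*-monoʳ-≤ 8 (m≤m*n q (suc b))) (*-monoʳ-≤ 56 (m≤m*n q (suc b)))) ⟩
    -- `K₂` contributes `528`, and the added `8` rounds `528 + 8 + 56` up to `600`.
    K₂ + (8 * (q * suc b) + 56 * (q * suc b)) ≤⟨ m≤m+n _ (8 * (q * suc b)) ⟩
    K₂ + (8 * (q * suc b) + 56 * (q * suc b)) + 8 * (q * suc b) ≡⟨ collect a (suc b) ⟩
    600 * a * (suc b * (suc b * 1)) ≤⟨ *-monoʳ-≤ (600 * a) (^-monoʳ-≤ (suc b) {2} {7} (s≤s (s≤s z≤n))) ⟩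
    600 * a * suc b ^ 7 ∎
    where
    open ≤-Reasoning
    collect : ∀ a b → 8 * ((33 * (a * b) + 33 * (a * b)) * b) + (8 * (a * b * b) + 56 * (a * b * b)) + 8 * (a * b * b) ≡ 600 * a * (b * (b * 1))
    collect = solve-∀

  -- Each spider starts with `4 c` edges, and by the choice of `K₂` at least seven eighths survive,
  -- that is `7 c / 2`. Pruning spends `3 c` per spider and `4 a` per vertex, where a spider has at
  -- most `4 * suc b` vertices, so `3 c + 16 q` in all. Hence `c` must exceed `32 * q`, and `33 * q`
  -- is taken.
  dense : ∀ ℓ u e → 0 < ℓ → u ≤ ℓ * suc (suc b + (suc b + suc b)) →
    (ℓ * 2) * ((c + c) * (K₂ ∸ (c + c) * suc b)) ≤ K₂ * e → (c + c + c) * ℓ + 4 * a * u < e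
  dense ℓ u e 0<ℓ u≤ many = *-cancelˡ-< 2 _ _ (<-≤-trans below (*-cancelˡ-≤ 4 above))
    where
    open ≤-Reasoning
    y : ℕ
    y = (c + c) * suc b
    0<y : 0 < y
    0<y = s≤s z≤n
    above : 4 * (7 * (ℓ * c)) ≤ 4 * (2 * e)
    above = *-cancelˡ-≤ y {{>-nonZero 0<y}} (begin
      y * (4 * (7 * (ℓ * c))) ≡⟨ shape y ℓ c ⟩
      (ℓ * 2) * ((c + c) * (7 * y)) ≡⟨ cong (λ x → (ℓ * 2) * ((c + c) * x)) (m+n∸m≡n y (7 * y)) ⟨
      (ℓ * 2) * ((c + c) * (y + 7 * y ∸ y)) ≤⟨ many ⟩
      K₂ * e ≡⟨ shape′ y e ⟩
      y * (4 * (2 * e)) ∎)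
      where
      shape : ∀ y ℓ c → y * (4 * (7 * (ℓ * c))) ≡ (ℓ * 2) * ((c + c) * (7 * y))
      shape = solve-∀
      shape′ : ∀ y e → 8 * y * e ≡ y * (4 * (2 * e))
      shape′ = solve-∀
    u≤′ : u ≤ ℓ * (4 * suc b)
    u≤′ = ≤-trans u≤ (*-monoʳ-≤ ℓ (≤-trans (m≤m+n _ b) (≤-reflexive (four b))))
      where
      four : ∀ b → suc (suc b + (suc b + suc b)) + b ≡ 4 * suc b
      four = solve-∀
    below : 2 * ((c + c + c) * ℓ + 4 * a * u) < 7 * (ℓ * c)
    below = begin-strict
      2 * ((c + c + c) * ℓ + 4 * a * u) ≤⟨ *-monoʳ-≤ 2 (+-monoʳ-≤ ((c + c + c) * ℓ) (*-monoʳ-≤ (4 * a) u≤′)) ⟩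
      2 * ((c + c + c) * ℓ + 4 * a * (ℓ * (4 * suc b))) <⟨ m<m+n _ (*-mono-≤ {1} {q} {1} {ℓ} (s≤s z≤n) 0<ℓ) ⟩
      2 * ((c + c + c) * ℓ + 4 * a * (ℓ * (4 * suc b))) + q * ℓ ≡⟨ total a (suc b) ℓ ⟩
      7 * (ℓ * c) ∎
      where
      total : ∀ a b ℓ → 2 * ((33 * (a * b) + 33 * (a * b) + 33 * (a * b)) * ℓ + 4 * a * (ℓ * (4 * b))) + a * b * ℓ ≡ 7 * (ℓ * (33 * (a * b)))
      total = solve-∀

theorem2p2 : ∃ λ (C : ℕ) → ∀ (a b : ℕ) → 2 ≤ a → 1 ≤ b →
    (D : Digraph) → 0 < n D →
    (∀ v → C * a * b ^ 7 ≤ outdeg D v) →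
    GirthAtLeast D (4 * b ^ 2) →
    Subdivision (Cab a b) D
theorem2p2 = 600 , λ { (suc (suc m)) (suc b) (s≤s (s≤s z≤n)) (s≤s z≤n) D 0<n rich _ →
  subdivision (Construction.frame D 0<n (sizes m b) rich) }
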